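{- Let $X\subseteq U$ be a fixed set of $|X|=m$ keys, and let $S\subseteq[2^r]$ with $|S|/2^r=\rho$. Let $h:U\to[2^r]$ be a simple tabulation hash function, and define $p_0'=1-(1-\rho)^m$. If $p$ denotes the probability that $h(X)\cap S\neq\emptyset$, then $$|p-p_0'|\le m^{2-1/c}\rho^2.$$ Moreover, if $q\in U\setminus X$ is a distinguished query key and $S$ (and hence $\rho$) is allowed to depend on $h(q)$, i.e. for every $z\in[2^r]$, conditioned on $h(q)=z$ the set $S$ is a fixed function of $z$ and $p$ denotes the conditional probability that $h(X)\cap S\ne\emptyset$, then $|p-p_0'|\le 2m^{2-1/c}\rho^2$.
   Context: Simple tabulation hashing: the key universe is $U=[u]$, each key $x\in U$ is viewed as a vector $(x[0],\dots,x[c-1])$ of $c=O(1)$ characters from $\Sigma=[u^{1/c}]$; the range is $[2^r]$, viewed as $r$-bit strings. $h(x)=h_0(x[0])\oplus\cdots\oplus h_{c-1}(x[c-1])$ with $h_0,\dots,h_{c-1}:\Sigma\to[2^r]$ independent fully random functions and $\oplus$ bitwise XOR. -}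

module Defs where

open import Algebra.Bundles using (CommutativeRing)
open import Data.Bool.Base using (_xor_)
open import Data.Empty using (⊥-elim-irr)
open import Data.Fin.Base using (Fin; zero; suc; combine; finToFun; funToFin)
open import Data.Fin.Properties using (2↔Bool; any?; finToFun-funToFin; funToFin-finToFin)
open import Data.Fin.Subset using (Subset; _∈_; ∣_∣)
open import Data.Fin.Subset.Properties using (_∈?_)
open import Data.Integer.Base using (+_)
open import Data.List.Base using (allFin; filter; length)
open import Data.List.Membership.Propositional.Properties using (∈-allFin; ∈-filter⁺; ∈-length)
open import Data.Nat.Base using (ℕ; zero; suc; _^_; NonZero; >-nonZero)
open import Data.Nat.Properties using (m^n≢0)
open import Data.Product.Base using (∃; _×_; _,_)
open import Data.Rational.Base using (ℚ; 1ℚ; _/_; _-_; _*_; _≤_)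
open import Data.Rational.Properties using (+-*-commutativeRing)
open import Data.Vec.Functional using (foldr)
open import Function.Bundles using (Inverse)
open import Level using (0ℓ)
open import Relation.Binary.PropositionalEquality using (_≡_; refl; trans; cong; cong₂; _≗_)
open import Relation.Nullary.Decidable using (_×-dec_)
open import Relation.Unary using (Pred; Decidable; _∩_)

import Algebra.Properties.Semiring.Exp as Exp
import Data.Fin.Properties as Fin

open Exp (CommutativeRing.semiring +-*-commutativeRing) public
  using () renaming (_^_ to _^ℚ_)

fromℕ : ℕ → ℚ
fromℕ n = + n / 1

-- x ≤ y · b^(n/d), where b^(n/d) is in general an irrational real.  For
-- x , y ≥ 0 and d ≥ 1 this is the inequality with both sides raised to the
-- d-th power, which t ↦ t^d preserves and reflects on nonnegative reals.
infix 4 _≤_·_^[_/_]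

_≤_·_^[_/_] : ℚ → ℚ → ℕ → ℕ → ℕ → Set
x ≤ y · b ^[ n / d ] = x ^ℚ d ≤ (y ^ℚ d) * fromℕ (b ^ n)

count : ∀ {n} {A : Pred (Fin n) 0ℓ} → Decidable A → ℕ
count A? = length (filter A? (allFin _))

Pr[_] : ∀ {n} .{{_ : NonZero n}} {A : Pred (Fin n) 0ℓ} → Decidable A → ℚ
Pr[_] {n} A? = + count A? / n

_∩?_ : ∀ {n} {A B : Pred (Fin n) 0ℓ} → Decidable A → Decidable B → Decidable (A ∩ B)
(A? ∩? B?) ω = A? ω ×-dec B? ω

Pr[_∣_] : ∀ {n} {A B : Pred (Fin n) 0ℓ} →
          Decidable A → (B? : Decidable B) → .{{_ : NonZero (count B?)}} → ℚ
Pr[ A? ∣ B? ] = + count (A? ∩? B?) / count B?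

count-nonZero : ∀ {n} {A : Pred (Fin n) 0ℓ} (A? : Decidable A) ω → A ω → NonZero (count A?)
count-nonZero A? ω a = >-nonZero (∈-length (∈-filter⁺ A? (∈-allFin ω) a))

[2^_] : ℕ → Set
[2^ r ] = Fin (2 ^ r)

bit-xor : Fin 2 → Fin 2 → Fin 2
bit-xor a b = from (to a xor to b)
  where open Inverse 2↔Bool

0ᵇ : ∀ r → [2^ r ]
0ᵇ r = funToFin {r} {2} (λ _ → zero)

xorᵇ : ∀ r → [2^ r ] → [2^ r ] → [2^ r ]
xorᵇ r a b = funToFin {r} {2} λ k → bit-xor (finToFun {2} {r} a k) (finToFun {2} {r} b k)

-- U = [u] with u = σ^c, where σ = ∣Σ∣.
Key : (c σ : ℕ) → Set
Key c σ = Fin (σ ^ c)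

char : ∀ c σ → Key c σ → Fin c → Fin σ
char c σ = finToFun {σ} {c}

∣Ω∣ : (c σ r : ℕ) → ℕ
∣Ω∣ c σ r = ((2 ^ r) ^ σ) ^ c

-- finToFun makes Ω biject with the c-tuples of functions Fin σ → [2^ r ], so
-- uniform ω means independent, fully random character tables.
Ω : (c σ r : ℕ) → Set
Ω c σ r = Fin (∣Ω∣ c σ r)

table : ∀ c σ r → Ω c σ r → Fin c → Fin σ → [2^ r ]
table c σ r ω i = finToFun {2 ^ r} {σ} (finToFun {(2 ^ r) ^ σ} {c} ω i)

hash : ∀ c σ r → Ω c σ r → Key c σ → [2^ r ]
hash c σ r ω x = foldr (xorᵇ r) (0ᵇ r) {c} (λ i → table c σ r ω i (char c σ x i))

∣Ω∣-nonZero : ∀ c σ r → NonZero (∣Ω∣ c σ r)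
∣Ω∣-nonZero c σ r = m^n≢0 _ c {{m^n≢0 _ σ {{m^n≢0 2 r}}}}

-- h(X) ∩ S ≠ ∅ for h = hash c σ r ω.
Hits : ∀ c σ r → Subset (σ ^ c) → Subset (2 ^ r) → Pred (Ω c σ r) 0ℓ
Hits c σ r X S ω = ∃ λ x → x ∈ X × hash c σ r ω x ∈ S

hits? : ∀ c σ r X S → Decidable (Hits c σ r X S)
hits? c σ r X S ω = any? λ x → (x ∈? X) ×-dec (hash c σ r ω x ∈? S)

HashesTo : ∀ c σ r → Key c σ → [2^ r ] → Pred (Ω c σ r) 0ℓ
HashesTo c σ r q z ω = hash c σ r ω q ≡ z

hashesTo? : ∀ c σ r q z → Decidable (HashesTo c σ r q z)
hashesTo? c σ r q z ω = hash c σ r ω q Fin.≟ z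

density : ∀ r → Subset (2 ^ r) → ℚ
density r S = _/_ (+ ∣ S ∣) (2 ^ r) {{m^n≢0 2 r}}

p₀′ : ℕ → ℚ → ℚ
p₀′ m ρ = 1ℚ - (1ℚ - ρ) ^ℚ m

funToFin-cong : ∀ {m n} {f g : Fin m → Fin n} → f ≗ g → funToFin f ≡ funToFin g
funToFin-cong {zero}  f≗g = refl
funToFin-cong {suc m} f≗g =
  cong₂ combine (f≗g zero) (funToFin-cong {m} (λ i → f≗g (suc i)))

bit-xor-identityʳ : ∀ a → bit-xor a zero ≡ a
bit-xor-identityʳ zero       = refl
bit-xor-identityʳ (suc zero) = refl

xorᵇ-identityʳ : ∀ r a → xorᵇ r a (0ᵇ r) ≡ a
xorᵇ-identityʳ r a = trans
  (funToFin-cong {r} λ k → trans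
    (cong (bit-xor (finToFun {2} {r} a k)) (finToFun-funToFin {r} {2} (λ _ → zero) k))
    (bit-xor-identityʳ _))
  (funToFin-finToFin {r} {2} a)

foldr-cong : ∀ {A : Set} (_∙_ : A → A → A) e {n} {f g : Fin n → A} →
             f ≗ g → foldr _∙_ e f ≡ foldr _∙_ e g
foldr-cong _∙_ e {zero}  f≗g = refl
foldr-cong _∙_ e {suc n} f≗g =
  cong₂ _∙_ (f≗g zero) (foldr-cong _∙_ e (λ i → f≗g (suc i)))

foldr-0ᵇ : ∀ r n → foldr (xorᵇ r) (0ᵇ r) {n} (λ _ → 0ᵇ r) ≡ 0ᵇ r
foldr-0ᵇ r zero    = refl
foldr-0ᵇ r (suc n) = trans (cong (xorᵇ r (0ᵇ r)) (foldr-0ᵇ r n)) (xorᵇ-identityʳ r (0ᵇ r))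

constTables : ∀ c σ r → (Fin c → [2^ r ]) → Ω c σ r
constTables c σ r v = funToFin {c} {(2 ^ r) ^ σ} λ i → funToFin {σ} {2 ^ r} λ _ → v i

table-constTables : ∀ c σ r v i a → table c σ r (constTables c σ r v) i a ≡ v i
table-constTables c σ r v i a = trans
  (cong (λ t → finToFun {2 ^ r} {σ} t a)
        (finToFun-funToFin {c} {(2 ^ r) ^ σ} (λ j → funToFin {σ} {2 ^ r} λ _ → v j) i))
  (finToFun-funToFin {σ} {2 ^ r} (λ _ → v i) a)

firstOnly : ∀ r n → [2^ r ] → Fin (suc n) → [2^ r ]
firstOnly r n z zero    = z
firstOnly r n z (suc _) = 0ᵇ r

-- For c ≥ 1 the event h(q) = z is possible, so conditioning on it is defined.
hashesTo-nonZero : ∀ c σ r .{{_ : NonZero c}} q z → NonZero (count (hashesTo? c σ r q z))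
hashesTo-nonZero zero    σ r {{c≢0}} q z = ⊥-elim-irr (NonZero.nonZero c≢0)
hashesTo-nonZero (suc n) σ r q z =
  count-nonZero (hashesTo? (suc n) σ r q z) (constTables (suc n) σ r (firstOnly r n z)) (trans
    (foldr-cong (xorᵇ r) (0ᵇ r) {suc n} λ i →
      table-constTables (suc n) σ r (firstOnly r n z) i (char (suc n) σ q i))
    (trans (cong (xorᵇ r z) (foldr-0ᵇ r n)) (xorᵇ-identityʳ r z)))

hitProb : ∀ c σ r → Subset (σ ^ c) → Subset (2 ^ r) → ℚ
hitProb c σ r X S = Pr[_] {{∣Ω∣-nonZero c σ r}} (hits? c σ r X S)

condHitProb : ∀ c σ r .{{_ : NonZero c}} → Subset (σ ^ c) → Subset (2 ^ r) → Key c σ → [2^ r ] → ℚ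
condHitProb c σ r X S q z =
  Pr[_∣_] (hits? c σ r X S) (hashesTo? c σ r q z) {{hashesTo-nonZero c σ r q z}}

{-# OPTIONS --safe #-}

-- Peel X into groups.  As long as keys remain, some position character α that
-- is not a character of q is shared by between 1 and 2 m^(1-1/c) of them:
-- otherwise every position would carry too few characters to tell the
-- remaining keys apart.  Let G be the g keys containing α and Y′ the other
-- remaining keys.  The table entry of α is independent of h(q) and of h on Y′,
-- so each x ∈ G hits S with probability exactly ρ given that Y′ avoids S,
-- while two distinct keys of G both hit S with probability ρ².  Bonferroni's
-- inequalities yield
--   P(Y′)(1 - gρ) ≤ P(Y′ ∪ G) ≤ P(Y′)(1 - gρ) + (g choose 2) ρ²
-- for the probability P(Y) that h(Y) avoids S, and the same bounds hold with
-- (1 - ρ)^∣Y∣ in place of P(Y).  If gρ ≤ 2, the distance between the two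
-- grows by at most (g choose 2) ρ² per group, which sums to at most
-- m^(2-1/c) ρ²; if gρ > 2 the bound exceeds 1 and is trivial.

module Submission where

open import Algebra.Bundles using (CommutativeRing)
open import Data.Bool.Base using (true; false; if_then_else_)
open import Data.Empty using (⊥-elim-irr)
open import Data.Fin.Base using (Fin; zero; suc; finToFun; funToFin)
open import Data.Fin.Permutation using (Permutation′; permutation)
open import Data.Fin.Properties as Fin using (any?; ¬∀⟶∃¬; finToFun-funToFin; funToFin-finToFin)
open import Data.Fin.Subset using (Subset; _∈_; _∉_; inside; outside) renaming (∣_∣ to card)
open import Data.Fin.Subset.Properties using (_∈?_)
open import Data.Integer.Base as ℤ using (+_)
open import Data.List.Base using (List; []; _∷_; _++_; length; filter; map; tabulate; allFin; deduplicate; fromMaybe; cartesianProductWith)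
open import Data.List.Membership.Propositional.Properties using (∈-∃++; ∈-++⁺ˡ; ∈-++⁺ʳ; ∈-++⁻; ∈-map⁺; ∈-map⁻; ∈-filter⁺; ∈-filter⁻; ∈-deduplicate⁺; ∈-deduplicate⁻; ∈-length; ∈-cartesianProductWith⁺; ∈-allFin)
open import Data.List.Properties using (length-++; length-map; length-filter)
open import Data.List.Relation.Unary.All as All using (All; []; _∷_)
open import Data.List.Relation.Unary.AllPairs using ([]; _∷_)
open import Data.List.Relation.Unary.Any using (here; there)
open import Data.List.Relation.Unary.Unique.DecPropositional.Properties using (deduplicate-!)
open import Data.List.Relation.Unary.Unique.Propositional using (Unique)
open import Data.Maybe.Base using (Maybe; just; nothing)
open import Data.Maybe.Properties using (≡-dec; just-injective)
open import Data.Nat.Base as ℕ using (ℕ; zero; suc; NonZero)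
open import Data.Nat.DivMod using (m/n*n≤m; m*n/n≡m; /-monoˡ-≤)
open import Data.Product.Base using (∃; ∃₂; _×_; _,_; proj₁; proj₂)
open import Data.Rational.Base using (ℚ; 0ℚ; 1ℚ; _+_; _-_; -_; _*_; _≤_; _/_; ∣_∣; nonNegative; Positive; toℚᵘ)
open import Data.Rational.Properties as ℚ using (≤-trans; ≤-refl; ≤-reflexive; +-*-commutativeRing)
open import Data.Rational.Solver using (module +-*-Solver)
open import Data.Sum.Base using (_⊎_; inj₁; inj₂)
open import Data.Vec.Base as Vec using (Vec; []; _∷_)
open import Data.Vec.Functional using (foldr)
open import Function.Base using (_∘_; id)
open import Level using (0ℓ)
open import Relation.Binary.PropositionalEquality
open import Relation.Nullary using (¬_; Dec; yes; no; ¬?; does; contradiction)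
open import Relation.Nullary.Decidable using (_×-dec_; dec-true; dec-false)
open import Relation.Unary using (Pred; Decidable)

import Algebra.Properties.CommutativeSemiring.Exp as Exp
import Algebra.Properties.Semiring.Sum as Sum
import Data.Integer.Properties as ℤ
import Data.List.Membership.Propositional as List
import Data.List.Relation.Unary.All.Properties as All
import Data.List.Relation.Unary.Unique.Propositional.Properties as Unique
import Data.Nat.Properties as ℕ
import Data.Rational.Unnormalised.Base as ℚᵘ
import Data.Rational.Unnormalised.Properties as ℚᵘ
import Data.Vec.Properties as Vec

open import Defs
open +-*-Solver using (solve; con; _:=_; _:+_; _:*_; _:-_; :-_)
open Exp (CommutativeRing.commutativeSemiring +-*-commutativeRing) using (^-distrib-*)
open Sum (CommutativeRing.semiring +-*-commutativeRing)

-- Order arithmetic on the rationals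

2ℚ : ℚ
2ℚ = 1ℚ + 1ℚ

≤-offset : ∀ {p q d} → 0ℚ ≤ d → q ≡ p + d → p ≤ q
≤-offset {p} {q} {d} 0≤d eq = subst₂ _≤_ (ℚ.+-identityʳ p) (sym eq) (ℚ.+-monoʳ-≤ p 0≤d)

0≤-diff : ∀ {p q} → p ≤ q → 0ℚ ≤ q - p
0≤-diff {p} {q} p≤q = subst (_≤ q - p) (ℚ.+-inverseʳ p) (ℚ.+-monoˡ-≤ (- p) p≤q)

0≤-+ : ∀ {p q} → 0ℚ ≤ p → 0ℚ ≤ q → 0ℚ ≤ p + q
0≤-+ 0≤p 0≤q = ℚ.+-mono-≤ 0≤p 0≤q

*-monoˡ : ∀ {r p q} → 0ℚ ≤ r → p ≤ q → r * p ≤ r * q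
*-monoˡ {r} 0≤r = ℚ.*-monoˡ-≤-nonNeg r {{nonNegative 0≤r}}

*-monoʳ : ∀ {r p q} → 0ℚ ≤ r → p ≤ q → p * r ≤ q * r
*-monoʳ {r} 0≤r = ℚ.*-monoʳ-≤-nonNeg r {{nonNegative 0≤r}}

0≤-* : ∀ {p q} → 0ℚ ≤ p → 0ℚ ≤ q → 0ℚ ≤ p * q
0≤-* {p} {q} 0≤p 0≤q = subst (_≤ p * q) (ℚ.*-zeroʳ p) (*-monoˡ 0≤p 0≤q)

*-mono : ∀ {p q r s} → 0ℚ ≤ p → 0ℚ ≤ s → p ≤ q → r ≤ s → p * r ≤ q * s
*-mono 0≤p 0≤s p≤q r≤s = ≤-trans (*-monoˡ 0≤p r≤s) (*-monoʳ 0≤s p≤q)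

0≤1 : 0ℚ ≤ 1ℚ
0≤1 = ℚ.nonNegative⁻¹ 1ℚ

0≤2 : 0ℚ ≤ 2ℚ
0≤2 = ℚ.nonNegative⁻¹ 2ℚ

∣p∣≤ : ∀ {p b} → p ≤ b → - p ≤ b → ∣ p ∣ ≤ b
∣p∣≤ {p} p≤b -p≤b with ℚ.∣p∣≡p∨∣p∣≡-p p
... | inj₁ eq = subst (_≤ _) (sym eq) p≤b
... | inj₂ eq = subst (_≤ _) (sym eq) -p≤b

^-nonNeg : ∀ {p} n → 0ℚ ≤ p → 0ℚ ≤ p ^ℚ n
^-nonNeg zero    0≤p = 0≤1
^-nonNeg (suc n) 0≤p = 0≤-* 0≤p (^-nonNeg n 0≤p)

^-mono : ∀ {p q} n → 0ℚ ≤ p → p ≤ q → p ^ℚ n ≤ q ^ℚ n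
^-mono zero    0≤p p≤q = ≤-refl
^-mono (suc n) 0≤p p≤q =
  *-mono 0≤p (^-nonNeg n (≤-trans 0≤p p≤q)) p≤q (^-mono n 0≤p p≤q)

-- The embedding of the naturals into the rationals

toℚᵘ-fromℕ : ∀ n → toℚᵘ (fromℕ n) ℚᵘ.≃ ℚᵘ.mkℚᵘ (+ n) 0
toℚᵘ-fromℕ n = ℚ.toℚᵘ-fromℚᵘ (ℚᵘ.mkℚᵘ (+ n) 0)

fromℕ-+ : ∀ m n → fromℕ (m ℕ.+ n) ≡ fromℕ m + fromℕ n
fromℕ-+ m n = ℚ.toℚᵘ-injective (ℚᵘ.≃-trans (toℚᵘ-fromℕ (m ℕ.+ n)) (ℚᵘ.≃-trans
  (ℚᵘ.*≡* (cong (ℤ._* + 1) (cong₂ ℤ._+_ (sym (ℤ.*-identityʳ (+ m))) (sym (ℤ.*-identityʳ (+ n))))))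
  (ℚᵘ.≃-sym (ℚᵘ.≃-trans (ℚ.toℚᵘ-homo-+ (fromℕ m) (fromℕ n))
    (ℚᵘ.+-cong (toℚᵘ-fromℕ m) (toℚᵘ-fromℕ n))))))

fromℕ-* : ∀ m n → fromℕ (m ℕ.* n) ≡ fromℕ m * fromℕ n
fromℕ-* m n = ℚ.toℚᵘ-injective (ℚᵘ.≃-trans (toℚᵘ-fromℕ (m ℕ.* n)) (ℚᵘ.≃-trans
  (ℚᵘ.*≡* (cong (ℤ._* + 1) (ℤ.pos-* m n)))
  (ℚᵘ.≃-sym (ℚᵘ.≃-trans (ℚ.toℚᵘ-homo-* (fromℕ m) (fromℕ n))
    (ℚᵘ.*-cong (toℚᵘ-fromℕ m) (toℚᵘ-fromℕ n))))))

fromℕ-^ : ∀ m n → fromℕ (m ℕ.^ n) ≡ fromℕ m ^ℚ n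
fromℕ-^ m zero    = refl
fromℕ-^ m (suc n) = trans (fromℕ-* m (m ℕ.^ n)) (cong (fromℕ m *_) (fromℕ-^ m n))

fromℕ-nonNeg : ∀ n → 0ℚ ≤ fromℕ n
fromℕ-nonNeg n = ℚ.nonNegative⁻¹ (fromℕ n) {{ℚ.normalize-nonNeg n 1}}

fromℕ-mono : ∀ {m n} → m ℕ.≤ n → fromℕ m ≤ fromℕ n
fromℕ-mono {m} {n} m≤n = ≤-offset (fromℕ-nonNeg (n ℕ.∸ m))
  (trans (cong fromℕ (sym (ℕ.m+[n∸m]≡n m≤n))) (fromℕ-+ m (n ℕ.∸ m)))

/-* : ∀ k n .{{_ : NonZero n}} → (+ k / n) * fromℕ n ≡ fromℕ k
/-* k n@(suc n-1) = ℚ.toℚᵘ-injective (ℚᵘ.≃-trans (ℚ.toℚᵘ-homo-* (+ k / n) (fromℕ n))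
  (ℚᵘ.≃-trans (ℚᵘ.*-cong (ℚ.toℚᵘ-fromℚᵘ (ℚᵘ.mkℚᵘ (+ k) n-1)) (toℚᵘ-fromℕ n))
  (ℚᵘ.≃-trans (ℚᵘ.*≡* (trans (ℤ.*-identityʳ (+ k ℤ.* + n)) (cong (λ j → + k ℤ.* + j) (sym (ℕ.*-identityʳ n)))))
  (ℚᵘ.≃-sym (toℚᵘ-fromℕ k)))))

fromℕ-pos : ∀ n .{{_ : NonZero n}} → Positive (fromℕ n)
fromℕ-pos n = ℚ.normalize-pos n 1

fromℕ-cancelʳ : ∀ n .{{_ : NonZero n}} {p q} → p * fromℕ n ≡ q * fromℕ n → p ≡ q
fromℕ-cancelʳ n {p} {q} eq = ℚ.≤-antisym
  (ℚ.*-cancelʳ-≤-pos (fromℕ n) {{fromℕ-pos n}} (≤-reflexive eq))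
  (ℚ.*-cancelʳ-≤-pos (fromℕ n) {{fromℕ-pos n}} (≤-reflexive (sym eq)))

-- Bonferroni's inequalities for products Π (1 − f x)

module _ {A : Set} (f : A → ℚ) where

  -- The first two elementary symmetric sums of the values of `f`, and the product of the factors
  -- `1 - f x`. For hit indicators `misses` is the indicator that no key hits; for the constant `ρ`
  -- it is the avoidance probability under full independence.
  total pairs misses : List A → ℚ
  total []       = 0ℚ
  total (x ∷ xs) = f x + total xs
  pairs []       = 0ℚ
  pairs (x ∷ xs) = f x * total xs + pairs xs
  misses []       = 1ℚ
  misses (x ∷ xs) = (1ℚ - f x) * misses xs

  module _ (0≤f : ∀ x → 0ℚ ≤ f x) where

    total-nonNeg : ∀ xs → 0ℚ ≤ total xs
    total-nonNeg []       = ≤-refl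
    total-nonNeg (x ∷ xs) = 0≤-+ (0≤f x) (total-nonNeg xs)

    pairs-nonNeg : ∀ xs → 0ℚ ≤ pairs xs
    pairs-nonNeg []       = ≤-refl
    pairs-nonNeg (x ∷ xs) = 0≤-+ (0≤-* (0≤f x) (total-nonNeg xs)) (pairs-nonNeg xs)

    module _ (f≤1 : ∀ x → f x ≤ 1ℚ) where

      misses-nonNeg : ∀ xs → 0ℚ ≤ misses xs
      misses-nonNeg []       = 0≤1
      misses-nonNeg (x ∷ xs) = 0≤-* (0≤-diff (f≤1 x)) (misses-nonNeg xs)

      misses≤1 : ∀ xs → misses xs ≤ 1ℚ
      misses≤1 []       = ≤-refl
      misses≤1 (x ∷ xs) = ≤-trans (*-monoˡ (0≤-diff (f≤1 x)) (misses≤1 xs))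
        (≤-offset (0≤f x) (solve 1 (λ a → con 1ℚ := (con 1ℚ :- a) :* con 1ℚ :+ a) refl (f x)))

      -- Multiplying the induction hypothesis by `1 - f x ≥ 0` leaves the surplus `f x * total xs`,
      -- which is dropped. The upper bound likewise gives away `f x * pairs xs`.
      bonferroni-lower : ∀ xs → 1ℚ - total xs ≤ misses xs
      bonferroni-lower []       = ≤-refl
      bonferroni-lower (x ∷ xs) = ≤-trans
        (≤-offset (0≤-* (0≤f x) (total-nonNeg xs))
          (solve 2 (λ a s → (con 1ℚ :- a) :* (con 1ℚ :- s) := (con 1ℚ :- (a :+ s)) :+ a :* s) refl (f x) (total xs)))
        (*-monoˡ (0≤-diff (f≤1 x)) (bonferroni-lower xs))

      bonferroni-upper : ∀ xs → misses xs ≤ 1ℚ - total xs + pairs xs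
      bonferroni-upper []       = ≤-refl
      bonferroni-upper (x ∷ xs) = ≤-trans
        (*-monoˡ (0≤-diff (f≤1 x)) (bonferroni-upper xs))
        (≤-offset (0≤-* (0≤f x) (pairs-nonNeg xs))
          (solve 3 (λ a s p → con 1ℚ :- (a :+ s) :+ (a :* s :+ p)
                     := (con 1ℚ :- a) :* (con 1ℚ :- s :+ p) :+ a :* p) refl (f x) (total xs) (pairs xs)))

module _ {A : Set} (ρ : ℚ) where

  total-const : ∀ (xs : List A) → total (λ _ → ρ) xs ≡ fromℕ (length xs) * ρ
  total-const []       = sym (ℚ.*-zeroˡ ρ)
  total-const (x ∷ xs) = trans (cong (_+_ ρ) (total-const xs)) (trans
    (solve 2 (λ ρ n → ρ :+ n :* ρ := (con 1ℚ :+ n) :* ρ) refl ρ (fromℕ (length xs)))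
    (cong (_* ρ) (sym (fromℕ-+ 1 (length xs)))))

  -- For `g` entries the left side is exactly `g (g - 1) ρ²`. The factor 2 avoids a division, and
  -- the surplus of `g²` is what makes a group of size at most `K` cost at most `g K ρ²` later.
  pairs-const : 0ℚ ≤ ρ → ∀ (xs : List A) →
    2ℚ * pairs (λ _ → ρ) xs ≤ fromℕ (length xs) * fromℕ (length xs) * (ρ * ρ)
  pairs-const _ []       = ≤-reflexive
    (solve 1 (λ r → (con 1ℚ :+ con 1ℚ) :* con 0ℚ := con 0ℚ :* con 0ℚ :* r) refl (ρ * ρ))
  pairs-const 0≤ρ (x ∷ xs) rewrite total-const xs | fromℕ-+ 1 (length xs) = ≤-trans
    (≤-reflexive (solve 3 (λ ρ n t → (con 1ℚ :+ con 1ℚ) :* (ρ :* (n :* ρ) :+ t)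
                                       := (con 1ℚ :+ con 1ℚ) :* t :+ (n :+ n) :* (ρ :* ρ))
                          refl ρ n (pairs (λ _ → ρ) xs)))
    (≤-trans (ℚ.+-monoˡ-≤ _ (pairs-const 0≤ρ xs))
    (≤-offset (0≤-* 0≤ρ 0≤ρ)
      (solve 2 (λ n r → (con 1ℚ :+ n) :* (con 1ℚ :+ n) :* r := n :* n :* r :+ (n :+ n) :* r :+ r)
               refl n (ρ * ρ))))
    where
    n = fromℕ (length xs)

  misses-const : ∀ (xs : List A) → misses (λ _ → ρ) xs ≡ (1ℚ - ρ) ^ℚ length xs
  misses-const []       = refl
  misses-const (x ∷ xs) = cong ((1ℚ - ρ) *_) (misses-const xs)

-- Bitwise XOR

finToFun-injective : ∀ {m n} {a b : Fin (n ℕ.^ m)} → finToFun {n} {m} a ≗ finToFun b → a ≡ b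
finToFun-injective {m} {n} {a} {b} a≗b = trans (sym (funToFin-finToFin {m} {n} a))
  (trans (funToFin-cong {m} {n} a≗b) (funToFin-finToFin {m} {n} b))

bit-xor-assoc : ∀ a b c → bit-xor (bit-xor a b) c ≡ bit-xor a (bit-xor b c)
bit-xor-assoc zero       zero       zero       = refl
bit-xor-assoc zero       zero       (suc zero) = refl
bit-xor-assoc zero       (suc zero) zero       = refl
bit-xor-assoc zero       (suc zero) (suc zero) = refl
bit-xor-assoc (suc zero) zero       zero       = refl
bit-xor-assoc (suc zero) zero       (suc zero) = refl
bit-xor-assoc (suc zero) (suc zero) zero       = refl
bit-xor-assoc (suc zero) (suc zero) (suc zero) = refl

bit-xor-comm : ∀ a b → bit-xor a b ≡ bit-xor b a
bit-xor-comm zero       zero       = refl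
bit-xor-comm zero       (suc zero) = refl
bit-xor-comm (suc zero) zero       = refl
bit-xor-comm (suc zero) (suc zero) = refl

bit-xor-self : ∀ a → bit-xor a a ≡ zero
bit-xor-self zero       = refl
bit-xor-self (suc zero) = refl

module Xor (r : ℕ) where

  infixl 6 _⊕_
  _⊕_ : [2^ r ] → [2^ r ] → [2^ r ]
  _⊕_ = xorᵇ r

  bit : [2^ r ] → Fin r → Fin 2
  bit = finToFun {2} {r}

  bit-⊕ : ∀ a b k → bit (a ⊕ b) k ≡ bit-xor (bit a k) (bit b k)
  bit-⊕ a b = finToFun-funToFin {r} {2} _

  ⊕-assoc : ∀ a b c → (a ⊕ b) ⊕ c ≡ a ⊕ (b ⊕ c)
  ⊕-assoc a b c = finToFun-injective {r} {2} λ k → begin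
    bit ((a ⊕ b) ⊕ c) k                           ≡⟨ bit-⊕ (a ⊕ b) c k ⟩
    bit-xor (bit (a ⊕ b) k) (bit c k)             ≡⟨ cong (λ v → bit-xor v (bit c k)) (bit-⊕ a b k) ⟩
    bit-xor (bit-xor (bit a k) (bit b k)) (bit c k) ≡⟨ bit-xor-assoc (bit a k) (bit b k) (bit c k) ⟩
    bit-xor (bit a k) (bit-xor (bit b k) (bit c k)) ≡⟨ cong (bit-xor (bit a k)) (bit-⊕ b c k) ⟨
    bit-xor (bit a k) (bit (b ⊕ c) k)             ≡⟨ bit-⊕ a (b ⊕ c) k ⟨
    bit (a ⊕ (b ⊕ c)) k                           ∎
    where open ≡-Reasoning

  ⊕-comm : ∀ a b → a ⊕ b ≡ b ⊕ a
  ⊕-comm a b = finToFun-injective {r} {2} λ k →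
    trans (bit-⊕ a b k) (trans (bit-xor-comm (bit a k) (bit b k)) (sym (bit-⊕ b a k)))

  ⊕-self : ∀ a → a ⊕ a ≡ 0ᵇ r
  ⊕-self a = finToFun-injective {r} {2} λ k → trans (bit-⊕ a a k)
    (trans (bit-xor-self (bit a k)) (sym (finToFun-funToFin {r} {2} (λ _ → zero) k)))

  ⊕-cancel : ∀ a b → a ⊕ (a ⊕ b) ≡ b
  ⊕-cancel a b = begin
    a ⊕ (a ⊕ b) ≡⟨ ⊕-assoc a a b ⟨
    (a ⊕ a) ⊕ b ≡⟨ cong (_⊕ b) (⊕-self a) ⟩
    0ᵇ r ⊕ b    ≡⟨ ⊕-comm (0ᵇ r) b ⟩
    b ⊕ 0ᵇ r    ≡⟨ xorᵇ-identityʳ r b ⟩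
    b           ∎
    where open ≡-Reasoning

  ⨁ : ∀ {n} → (Fin n → [2^ r ]) → [2^ r ]
  ⨁ {n} = foldr _⊕_ (0ᵇ r) {n}

  -- Associativity and commutativity carry the translation of one summand past the summands before
  -- it.
  ⨁-shift : ∀ {n} (f g : Fin n → [2^ r ]) j t → g j ≡ t ⊕ f j →
            (∀ i → i ≢ j → g i ≡ f i) → ⨁ g ≡ t ⊕ ⨁ f
  ⨁-shift f g zero    t gj rest = trans
    (cong₂ _⊕_ gj (foldr-cong _⊕_ (0ᵇ r) λ i → rest (suc i) λ ()))
    (⊕-assoc t (f zero) (⨁ (f ∘ suc)))
  ⨁-shift f g (suc j) t gj rest = begin
    g zero ⊕ ⨁ (g ∘ suc)        ≡⟨ cong₂ _⊕_ (rest zero λ ()) (⨁-shift (f ∘ suc) (g ∘ suc) j t gj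
                                      λ i i≢j → rest (suc i) (i≢j ∘ Fin.suc-injective)) ⟩
    f zero ⊕ (t ⊕ ⨁ (f ∘ suc))  ≡⟨ ⊕-assoc (f zero) t _ ⟨
    (f zero ⊕ t) ⊕ ⨁ (f ∘ suc)  ≡⟨ cong (_⊕ ⨁ (f ∘ suc)) (⊕-comm (f zero) t) ⟩
    (t ⊕ f zero) ⊕ ⨁ (f ∘ suc)  ≡⟨ ⊕-assoc t (f zero) _ ⟩
    t ⊕ (f zero ⊕ ⨁ (f ∘ suc))  ∎
    where open ≡-Reasoning

  ⊕-permutation : [2^ r ] → Permutation′ (2 ℕ.^ r)
  ⊕-permutation a = permutation (a ⊕_) (a ⊕_) (⊕-cancel a) (⊕-cancel a)

-- Translating a single table entry

module Shift (c σ r : ℕ) where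

  open Xor r

  fromTables : (Fin c → Fin σ → [2^ r ]) → Ω c σ r
  fromTables T = funToFin {c} {(2 ℕ.^ r) ℕ.^ σ} λ i → funToFin {σ} {2 ℕ.^ r} (T i)

  table-fromTables : ∀ T i a → table c σ r (fromTables T) i a ≡ T i a
  table-fromTables T i a = trans
    (cong (λ t → finToFun {2 ℕ.^ r} {σ} t a)
          (finToFun-funToFin {c} {(2 ℕ.^ r) ℕ.^ σ} (λ j → funToFin {σ} {2 ℕ.^ r} (T j)) i))
    (finToFun-funToFin {σ} {2 ℕ.^ r} (T i) a)

  table-injective : ∀ {ω ω′} → (∀ i a → table c σ r ω i a ≡ table c σ r ω′ i a) → ω ≡ ω′
  table-injective eq = finToFun-injective {c} {(2 ℕ.^ r) ℕ.^ σ} λ i →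
    finToFun-injective {σ} {2 ℕ.^ r} (eq i)

  module _ (j : Fin c) (a : Fin σ) (t : [2^ r ]) where

    shiftedTable : Ω c σ r → Fin c → Fin σ → [2^ r ]
    shiftedTable ω i b = if does (i Fin.≟ j ×-dec b Fin.≟ a) then t ⊕ table c σ r ω i b else table c σ r ω i b

    shift : Ω c σ r → Ω c σ r
    shift ω = fromTables (shiftedTable ω)

    table-shift-at : ∀ ω → table c σ r (shift ω) j a ≡ t ⊕ table c σ r ω j a
    table-shift-at ω = trans (table-fromTables (shiftedTable ω) j a)
      (cong (if_then t ⊕ table c σ r ω j a else table c σ r ω j a) (dec-true (j Fin.≟ j ×-dec a Fin.≟ a) (refl , refl)))

    table-shift-off : ∀ ω i b → ¬ (i ≡ j × b ≡ a) → table c σ r (shift ω) i b ≡ table c σ r ω i b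
    table-shift-off ω i b off = trans (table-fromTables (shiftedTable ω) i b)
      (cong (if_then t ⊕ table c σ r ω i b else table c σ r ω i b) (dec-false (i Fin.≟ j ×-dec b Fin.≟ a) off))

    shift-involutive : ∀ ω → shift (shift ω) ≡ ω
    shift-involutive ω = table-injective eq
      where
      eq : ∀ i b → table c σ r (shift (shift ω)) i b ≡ table c σ r ω i b
      eq i b with i Fin.≟ j ×-dec b Fin.≟ a
      ... | yes (refl , refl) = trans (table-shift-at (shift ω))
              (trans (cong (t ⊕_) (table-shift-at ω)) (⊕-cancel t _))
      ... | no off = trans (table-shift-off (shift ω) i b off) (table-shift-off ω i b off)

    -- Reindexing sums over `Ω` by this involution is the form in which uniformity of one table
    -- entry and its independence of all others are used.
    shift-permutation : Permutation′ (∣Ω∣ c σ r)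
    shift-permutation = permutation shift shift shift-involutive shift-involutive

    hash-shift : ∀ ω x → char c σ x j ≡ a → hash c σ r (shift ω) x ≡ t ⊕ hash c σ r ω x
    hash-shift ω x refl = ⨁-shift _ _ j t (table-shift-at ω)
      λ i i≢j → table-shift-off ω i _ λ (i≡j , _) → i≢j i≡j

    hash-shift-off : ∀ ω x → char c σ x j ≢ a → hash c σ r (shift ω) x ≡ hash c σ r ω x
    hash-shift-off ω x off = foldr-cong (xorᵇ r) (0ᵇ r) λ i →
      table-shift-off ω i _ λ { (refl , eq) → off eq }

-- Position characters shared by few keys

length-split : ∀ {A : Set} {P : Pred A 0ℓ} (P? : Decidable P) xs →
  length xs ≡ length (filter (¬? ∘ P?) xs) ℕ.+ length (filter P? xs)
length-split P? []       = refl
length-split P? (x ∷ xs) with does (P? x)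
... | true  = trans (cong suc (length-split P? xs)) (sym (ℕ.+-suc (length (filter (¬? ∘ P?) xs)) (length (filter P? xs))))
... | false = cong suc (length-split P? xs)

-- Pigeonhole: the occurrence of the head is cut out of `ys`, and by uniqueness the remaining
-- entries are still found in what is left.
Unique-⊆⇒length≤ : ∀ {A : Set} {xs ys : List A} → Unique xs → All (List._∈ ys) xs → length xs ℕ.≤ length ys
Unique-⊆⇒length≤ {xs = []} _ _ = ℕ.z≤n
Unique-⊆⇒length≤ {xs = x ∷ xs} (x∉xs ∷ uniq) (x∈ys ∷ xs⊆ys) with ∈-∃++ x∈ys
... | as , bs , refl = subst (suc (length xs) ℕ.≤_) (sym ∣ys∣≡)
  (ℕ.s≤s (Unique-⊆⇒length≤ uniq (All.zipWith drop (x∉xs , xs⊆ys))))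
  where
  drop : ∀ {y} → x ≢ y × y List.∈ as ++ x ∷ bs → y List.∈ as ++ bs
  drop (x≢y , y∈) with ∈-++⁻ as y∈
  ... | inj₁ y∈as         = ∈-++⁺ˡ y∈as
  ... | inj₂ (here y≡x)   = contradiction (sym y≡x) x≢y
  ... | inj₂ (there y∈bs) = ∈-++⁺ʳ as y∈bs
  ∣ys∣≡ : length (as ++ x ∷ bs) ≡ suc (length (as ++ bs))
  ∣ys∣≡ = trans (length-++ as) (trans (ℕ.+-suc (length as) (length bs)) (cong suc (sym (length-++ as))))

length-cartesianProductWith : ∀ {A B C : Set} (f : A → B → C) xs ys →
  length (cartesianProductWith f xs ys) ≡ length xs ℕ.* length ys
length-cartesianProductWith f []       ys = refl
length-cartesianProductWith f (x ∷ xs) ys = trans (length-++ (map (f x) ys))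
  (cong₂ ℕ._+_ (length-map (f x) ys) (length-cartesianProductWith f xs ys))

words : ∀ {A : Set} {n} → (Fin n → List A) → List (Vec A n)
words {n = zero}  V = [] ∷ []
words {n = suc n} V = cartesianProductWith _∷_ (V zero) (words (V ∘ suc))

length-words : ∀ {A : Set} {n u} (V : Fin n → List A) → (∀ j → length (V j) ℕ.≤ u) →
               length (words V) ℕ.≤ u ℕ.^ n
length-words {n = zero}  V V≤u = ℕ.≤-refl
length-words {n = suc n} V V≤u = ℕ.≤-trans
  (ℕ.≤-reflexive (length-cartesianProductWith _∷_ (V zero) (words (V ∘ suc))))
  (ℕ.*-mono-≤ (V≤u zero) (length-words (V ∘ suc) (V≤u ∘ suc)))

∈-words : ∀ {A : Set} {n} (V : Fin n → List A) {f : Fin n → A} → (∀ j → f j List.∈ V j) →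
          Vec.tabulate f List.∈ words V
∈-words {n = zero}  V f∈V = here refl
∈-words {n = suc n} V f∈V = ∈-cartesianProductWith⁺ _∷_ (f∈V zero) (∈-words (V ∘ suc) (f∈V ∘ suc))

filter-filter-¬ : ∀ {A : Set} {P Q : Pred A 0ℓ} (P? : Decidable P) (Q? : Decidable Q) →
  (∀ {x} → P x → ¬ Q x) → ∀ xs → filter Q? (filter (¬? ∘ P?) xs) ≡ filter Q? xs
filter-filter-¬ P? Q? disj []       = refl
filter-filter-¬ P? Q? disj (x ∷ xs) with P? x
... | no _ with does (Q? x)
...   | true  = cong (x ∷_) (filter-filter-¬ P? Q? disj xs)
...   | false = filter-filter-¬ P? Q? disj xs
filter-filter-¬ P? Q? disj (x ∷ xs) | yes p with Q? x
...   | yes q = contradiction q (disj p)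
...   | no  _ = filter-filter-¬ P? Q? disj xs

module _ {A B : Set} (f : A → B) (_≟_ : (x y : B) → Dec (x ≡ y)) where

  fibre : B → List A → List A
  fibre b = filter (λ x → f x ≟ b)

  -- Distinct values have disjoint fibres: removing the fibre of `b` takes away at least `L` entries
  -- and leaves the fibres of the other values intact.
  length-fibres : ∀ {L} bs xs → Unique bs → All (λ b → L ℕ.≤ length (fibre b xs)) bs →
                  length bs ℕ.* L ℕ.≤ length xs
  length-fibres []       xs _             _           = ℕ.z≤n
  length-fibres {L} (b ∷ bs) xs (b∉bs ∷ uniq) (L≤ ∷ L≤s) = subst (L ℕ.+ length bs ℕ.* L ℕ.≤_)
    (trans (ℕ.+-comm (length (fibre b xs)) (length rest)) (sym (length-split (λ x → f x ≟ b) xs)))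
    (ℕ.+-mono-≤ L≤ (length-fibres bs rest uniq (All.zipWith keep (b∉bs , L≤s))))
    where
    rest = filter (λ x → ¬? (f x ≟ b)) xs
    keep : ∀ {b′} → b ≢ b′ × L ℕ.≤ length (fibre b′ xs) → L ℕ.≤ length (fibre b′ rest)
    keep {b′} (b≢b′ , L≤) = subst (λ ys → L ℕ.≤ length ys) (sym (filter-filter-¬ (λ x → f x ≟ b) (λ x → f x ≟ b′)
      (λ fx≡b fx≡b′ → b≢b′ (trans (sym fx≡b) fx≡b′)) xs)) L≤

^-distribʳ-* : ∀ m n k → (m ℕ.* n) ℕ.^ k ≡ m ℕ.^ k ℕ.* n ℕ.^ k
^-distribʳ-* m n zero    = refl
^-distribʳ-* m n (suc k) = trans (cong (m ℕ.* n ℕ.*_) (^-distribʳ-* m n k))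
  (ℕ.[m*n]*[o*p]≡[m*o]*[n*p] m n (m ℕ.^ k) (n ℕ.^ k))

-- Integer part of the `c`-th root. Applied to `2^c m^(c-1)` it gives the integer part of
-- `2 m^(1-1/c)`, the permitted group size.
floor-root : ∀ c .{{_ : NonZero c}} T → ∃ λ K → K ℕ.^ c ℕ.≤ T × T ℕ.< suc K ℕ.^ c
floor-root c@(suc _) zero    = 0 , ℕ.z≤n , ℕ.m^n>0 1 c
floor-root c@(suc _) (suc T) with floor-root c T
... | K , K≤ , <K with suc K ℕ.^ c ℕ.≤? suc T
-- The root grows by at most one: `suc T ≤ (1 + K)^c < (2 + K)^c`.
...   | yes K+1≤ = suc K , K+1≤ , ℕ.≤-<-trans <K (ℕ.^-monoˡ-< c (ℕ.n<1+n (suc K)))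
...   | no  K+1≰ = K , ℕ.m≤n⇒m≤1+n K≤ , ℕ.≰⇒> K+1≰

module Keys (c σ : ℕ) where

  has? : ∀ j a → Decidable (λ x → char c σ x j ≡ a)
  has? j a x = char c σ x j Fin.≟ a

  separating : ∀ {x y} → x ≢ y → ∃ λ j → char c σ x j ≢ char c σ y j
  separating {x} {y} x≢y = ¬∀⟶∃¬ c _ (λ j → char c σ x j Fin.≟ char c σ y j)
    λ eq → x≢y (finToFun-injective {c} {σ} eq)

  -- q j ≡ just a protects the character a at position j.  The characters of
  -- the query key are protected; without a query nothing is.
  module _ (q : Fin c → Maybe (Fin σ)) where

    -- When `q` lists the characters of a query key, this says that `x` differs from that key. When
    -- nothing is protected, any position is a witness.
    Unprotected : Key c σ → Set
    Unprotected x = ∃ λ j → q j ≢ just (char c σ x j)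

    Splittable : ℕ → List (Key c σ) → Set
    Splittable K Y = ∃₂ λ j a → q j ≢ just a ×
      1 ℕ.≤ length (filter (has? j a) Y) × length (filter (has? j a) Y) ℕ.≤ K

    splittable? : ∀ K Y → Dec (Splittable K Y)
    splittable? K Y = any? λ j → any? λ a → ¬? (≡-dec Fin._≟_ (q j) (just a)) ×-dec
      (1 ℕ.≤? length (filter (has? j a) Y) ×-dec length (filter (has? j a) Y) ℕ.≤? K)

    module _ (Y : List (Key c σ)) where

      chars freeChars : Fin c → List (Fin σ)
      chars j = deduplicate Fin._≟_ (map (λ x → char c σ x j) Y)
      freeChars j = filter (λ a → ¬? (≡-dec Fin._≟_ (q j) (just a))) (chars j)

      ∈-chars : ∀ {x} j → x List.∈ Y → char c σ x j List.∈ chars j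
      ∈-chars j x∈Y = ∈-deduplicate⁺ Fin._≟_ (∈-map⁺ (λ x → char c σ x j) x∈Y)

      -- Each unprotected character occurring at position `j` has a fibre of more than `K` keys, and
      -- these fibres are disjoint parts of `Y`.
      length-freeChars : ∀ {K} → (∀ j a → q j ≢ just a → 1 ℕ.≤ length (filter (has? j a) Y) →
                            suc K ℕ.≤ length (filter (has? j a) Y)) →
                         ∀ j → length (freeChars j) ℕ.* suc K ℕ.≤ length Y
      length-freeChars {K} large j = length-fibres (λ x → char c σ x j) Fin._≟_ (freeChars j) Y
        (Unique.filter⁺ free? (deduplicate-! Fin._≟_ (map (λ x → char c σ x j) Y)))
        (All.tabulate λ {a} a∈ → large-at (∈-filter⁻ free? {xs = chars j} a∈))
        where
        free? : Decidable (λ a → q j ≢ just a)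
        free? a = ¬? (≡-dec Fin._≟_ (q j) (just a))
        large-at : ∀ {a} → a List.∈ chars j × q j ≢ just a → suc K ℕ.≤ length (filter (has? j a) Y)
        large-at {a} (a∈ , free) with ∈-map⁻ (λ x → char c σ x j) (∈-deduplicate⁻ Fin._≟_ (map (λ x → char c σ x j) Y) a∈)
        ... | x , x∈Y , a≡ = large j a free (∈-length (∈-filter⁺ (has? j a) x∈Y (sym a≡)))

      ∈-protected++free : ∀ {x} → x List.∈ Y → ∀ j → char c σ x j List.∈ fromMaybe (q j) ++ freeChars j
      ∈-protected++free {x} x∈Y j with ≡-dec Fin._≟_ (q j) (just (char c σ x j))
      ... | yes qj≡ = ∈-++⁺ˡ (subst (λ v → char c σ x j List.∈ fromMaybe v) (sym qj≡) (here refl))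
      ... | no free = ∈-++⁺ʳ (fromMaybe (q j)) (∈-filter⁺ _ (∈-chars j x∈Y) free)

      -- A key is determined by the word of its characters, and each letter is either the protected
      -- one at its position or one of the free ones. Hence `Y` embeds into the words over these
      -- alphabets.
      length≤words : Unique Y → ∀ u → (∀ j → length (fromMaybe (q j) ++ freeChars j) ℕ.≤ u) → length Y ℕ.≤ u ℕ.^ c
      length≤words uniq u ≤u = subst (ℕ._≤ u ℕ.^ c) (length-map toWord Y) (ℕ.≤-trans
        (Unique-⊆⇒length≤ (Unique.map⁺ toWord-injective uniq) (All.map⁺ (All.tabulate λ x∈Y →
          ∈-words (λ j → fromMaybe (q j) ++ freeChars j) (∈-protected++free x∈Y))))
        (length-words (λ j → fromMaybe (q j) ++ freeChars j) ≤u))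
        where
        toWord : Key c σ → Vec (Fin σ) c
        toWord x = Vec.tabulate (char c σ x)
        toWord-injective : ∀ {x y} → toWord x ≡ toWord y → x ≡ y
        toWord-injective {x} {y} eq = finToFun-injective {c} {σ} λ j → trans
          (sym (Vec.lookup∘tabulate (char c σ x) j))
          (trans (cong (λ v → Vec.lookup v j) eq) (Vec.lookup∘tabulate (char c σ y) j))

length-fromMaybe : ∀ {A : Set} (a : Maybe A) → length (fromMaybe a) ℕ.≤ 1
length-fromMaybe (just _) = ℕ.≤-refl
length-fromMaybe nothing  = ℕ.z≤n

module _ {k σ : ℕ} where

  private c = suc k
  open Keys c σ

  -- If all groups had more than K keys, every position would have at most
  -- t = n / (1 + K) unprotected characters, so n ≤ (1 + t)^c ≤ (2t)^c, against
  -- the choice of K.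
  small-group-exists : ∀ (q : Fin c → Maybe (Fin σ)) {K m} → 2 ℕ.^ c ℕ.* m ℕ.^ k ℕ.< suc K ℕ.^ c →
    ∀ Y → 1 ℕ.≤ length Y → length Y ℕ.≤ m → Unique Y → All (Unprotected q) Y → Splittable q K Y
  small-group-exists q {K} {m} root Y@(x ∷ _) _ Y≤m uniq ((i , xi-free) ∷ _) with splittable? q K Y
  ... | yes split = split
  ... | no ¬split = contradiction (ℕ.<-≤-trans n^c< n^c≥) (ℕ.<-irrefl refl)
    where
    n t : ℕ
    n = length Y
    t = n ℕ./ suc K
    frees : Fin c → List (Fin σ)
    frees = freeChars q Y
    frees≤t : ∀ j → length (frees j) ℕ.≤ t
    frees≤t j = subst (ℕ._≤ t) (m*n/n≡m (length (frees j)) (suc K)) (/-monoˡ-≤ (suc K)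
      (length-freeChars q Y (λ j a free 1≤ → ℕ.≰⇒> λ ≤K → ¬split (j , a , free , 1≤ , ≤K)) j))
    -- The first key has an unprotected character at position `i`. This makes room for the protected
    -- character, `1 + t ≤ 2t`, and keeps the inequality below strict.
    1≤t : 1 ℕ.≤ t
    1≤t = ℕ.≤-trans (∈-length (∈-filter⁺ (λ a → ¬? (≡-dec Fin._≟_ (q i) (just a)))
      (∈-chars q Y i (here refl)) xi-free)) (frees≤t i)
    t^c≢0 : NonZero (t ℕ.^ c)
    t^c≢0 = ℕ.m^n≢0 t c {{ℕ.>-nonZero 1≤t}}
    n≤ : n ℕ.≤ (t ℕ.* 2) ℕ.^ c
    n≤ = length≤words q Y uniq (t ℕ.* 2) λ j → ℕ.≤-trans
      (ℕ.≤-reflexive (length-++ (fromMaybe (q j))))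
      (ℕ.≤-trans (ℕ.+-mono-≤ (ℕ.≤-trans (length-fromMaybe (q j)) 1≤t) (frees≤t j))
      (ℕ.≤-reflexive (trans (cong (t ℕ.+_) (sym (ℕ.+-identityʳ t))) (ℕ.*-comm 2 t))))
    open ℕ.≤-Reasoning
    -- One factor `n` is bounded by the number of words, the other `k` factors by `m`; the factor
    -- `2^c m^k` that results is the one below `(1 + K)^c`.
    n^c< : n ℕ.^ c ℕ.< (t ℕ.* suc K) ℕ.^ c
    n^c< = begin-strict
      n ℕ.* n ℕ.^ k                            ≤⟨ ℕ.*-mono-≤ n≤ (ℕ.^-monoˡ-≤ k Y≤m) ⟩
      (t ℕ.* 2) ℕ.^ c ℕ.* m ℕ.^ k              ≡⟨ cong (ℕ._* m ℕ.^ k) (^-distribʳ-* t 2 c) ⟩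
      t ℕ.^ c ℕ.* 2 ℕ.^ c ℕ.* m ℕ.^ k          ≡⟨ ℕ.*-assoc (t ℕ.^ c) (2 ℕ.^ c) (m ℕ.^ k) ⟩
      t ℕ.^ c ℕ.* (2 ℕ.^ c ℕ.* m ℕ.^ k)        <⟨ ℕ.*-monoʳ-< (t ℕ.^ c) {{t^c≢0}} root ⟩
      t ℕ.^ c ℕ.* suc K ℕ.^ c                  ≡⟨ ^-distribʳ-* t (suc K) c ⟨
      (t ℕ.* suc K) ℕ.^ c                      ∎
    n^c≥ : (t ℕ.* suc K) ℕ.^ c ℕ.≤ n ℕ.^ c
    n^c≥ = ℕ.^-monoˡ-≤ c (m/n*n≤m n (suc K))

-- Sums and indicators

sum-mono : ∀ {n} {f g : Fin n → ℚ} → (∀ i → f i ≤ g i) → sum f ≤ sum g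
sum-mono {zero}  f≤g = ≤-refl
sum-mono {suc n} f≤g = ℚ.+-mono-≤ (f≤g zero) (sum-mono (f≤g ∘ suc))

sum-nonNeg : ∀ {n} {f : Fin n → ℚ} → (∀ i → 0ℚ ≤ f i) → 0ℚ ≤ sum f
sum-nonNeg {zero}  0≤f = ≤-refl
sum-nonNeg {suc n} 0≤f = 0≤-+ (0≤f zero) (sum-nonNeg (0≤f ∘ suc))

sum-const : ∀ n p → sum {n} (λ _ → p) ≡ fromℕ n * p
sum-const zero    p = sym (ℚ.*-zeroˡ p)
sum-const (suc n) p = trans (cong (_+_ p) (sum-const n p)) (trans
  (solve 2 (λ p n → p :+ n :* p := (con 1ℚ :+ n) :* p) refl p (fromℕ n))
  (cong (_* p) (sym (fromℕ-+ 1 n))))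

sum-diff : ∀ {n} (f g : Fin n → ℚ) → sum (λ i → f i - g i) ≡ sum f - sum g
sum-diff {zero}  f g = refl
sum-diff {suc n} f g = trans (cong (_+_ (f zero - g zero)) (sum-diff (f ∘ suc) (g ∘ suc)))
  (solve 4 (λ a b c d → a :- b :+ (c :- d) := a :+ c :- (b :+ d)) refl (f zero) (g zero) (sum (f ∘ suc)) (sum (g ∘ suc)))

indicator : ∀ {P : Set} → Dec P → ℚ
indicator d = if does d then 1ℚ else 0ℚ

indicator-nonNeg : ∀ {P : Set} (d : Dec P) → 0ℚ ≤ indicator d
indicator-nonNeg d with does d
... | true  = 0≤1
... | false = ≤-refl

indicator≤1 : ∀ {P : Set} (d : Dec P) → indicator d ≤ 1ℚ
indicator≤1 d with does d
... | true  = ≤-refl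
... | false = 0≤1

fromℕ-length-filter : ∀ {n} {A : Set} {P : Pred A 0ℓ} (P? : Decidable P) (f : Fin n → A) →
  fromℕ (length (filter P? (tabulate f))) ≡ sum (λ i → indicator (P? (f i)))
fromℕ-length-filter {zero}  P? f = refl
fromℕ-length-filter {suc n} P? f with does (P? (f zero))
... | true  = trans (fromℕ-+ 1 (length (filter P? (tabulate (f ∘ suc))))) (cong (_+_ 1ℚ) (fromℕ-length-filter P? (f ∘ suc)))
... | false = trans (fromℕ-length-filter P? (f ∘ suc)) (sym (ℚ.+-identityˡ _))

fromℕ-card : ∀ {n} (S : Subset n) → fromℕ (card S) ≡ sum (λ i → indicator (i ∈? S))
fromℕ-card []            = refl
fromℕ-card (inside  ∷ S) = trans (fromℕ-+ 1 (card S)) (cong (_+_ 1ℚ) (fromℕ-card S))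
fromℕ-card (outside ∷ S) = trans (fromℕ-card S) (sym (ℚ.+-identityˡ _))

module _ {A : Set} {P : Pred A 0ℓ} (P? : Decidable P) where

  misses-split : ∀ f xs → misses f xs ≡ misses f (filter (¬? ∘ P?) xs) * misses f (filter P? xs)
  misses-split f []       = refl
  misses-split f (x ∷ xs) with does (P? x)
  ... | true  = trans (cong ((1ℚ - f x) *_) (misses-split f xs))
    (solve 3 (λ a b c → a :* (b :* c) := b :* (a :* c)) refl (1ℚ - f x) (misses f (filter (¬? ∘ P?) xs)) (misses f (filter P? xs)))
  ... | false = trans (cong ((1ℚ - f x) *_) (misses-split f xs))
    (solve 3 (λ a b c → a :* (b :* c) := a :* b :* c) refl (1ℚ - f x) (misses f (filter (¬? ∘ P?) xs)) (misses f (filter P? xs)))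

misses-cong : ∀ {A : Set} {f g : A → ℚ} {xs} → All (λ x → f x ≡ g x) xs → misses f xs ≡ misses g xs
misses-cong []         = refl
misses-cong (eq ∷ eqs) = cong₂ (λ a b → (1ℚ - a) * b) eq (misses-cong eqs)

-- `P` and `Q` lie in windows of width `t` above `P′ (1 - s)` and `Q′ (1 - s)`, so `P - Q` is within
-- `t` of `(P′ - Q′)(1 - s)`. The range of `s` is exactly `∣ 1 - s ∣ ≤ 1`, so the old gap is not
-- amplified.
recurrence-gap : ∀ {P P′ Q Q′ s t} → 0ℚ ≤ s → s ≤ 2ℚ →
  P′ * (1ℚ - s) ≤ P → P ≤ P′ * (1ℚ - s) + t →
  Q′ * (1ℚ - s) ≤ Q → Q ≤ Q′ * (1ℚ - s) + t →
  ∣ P - Q ∣ ≤ ∣ P′ - Q′ ∣ + t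
recurrence-gap {P} {P′} {Q} {Q′} {s} {t} 0≤s s≤2 P≥ P≤ Q≥ Q≤ = ≤-trans
  (subst (_≤ ∣ D ∣ + ∣ P - Q - D ∣) (cong ∣_∣ (solve 3 (λ P Q D → D :+ (P :- Q :- D) := P :- Q) refl P Q D))
    (ℚ.∣p+q∣≤∣p∣+∣q∣ D (P - Q - D)))
  (ℚ.+-mono-≤ ∣D∣≤ (∣p∣≤
    (≤-offset (0≤-+ (0≤-diff P≤) (0≤-diff Q≥))
      (solve 6 (λ P P′ Q Q′ s t → t := (P :- Q :- (P′ :- Q′) :* (con 1ℚ :- s)) :+
        ((P′ :* (con 1ℚ :- s) :+ t :- P) :+ (Q :- Q′ :* (con 1ℚ :- s)))) refl P P′ Q Q′ s t))
    (≤-offset (0≤-+ (0≤-diff P≥) (0≤-diff Q≤))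
      (solve 6 (λ P P′ Q Q′ s t → t := (:- (P :- Q :- (P′ :- Q′) :* (con 1ℚ :- s))) :+
        ((P :- P′ :* (con 1ℚ :- s)) :+ (Q′ :* (con 1ℚ :- s) :+ t :- Q))) refl P P′ Q Q′ s t))))
  where
  D = (P′ - Q′) * (1ℚ - s)
  ∣D∣≤ : ∣ D ∣ ≤ ∣ P′ - Q′ ∣
  ∣D∣≤ = subst₂ _≤_ (sym (ℚ.∣p*q∣≡∣p∣*∣q∣ (P′ - Q′) (1ℚ - s))) (ℚ.*-identityʳ ∣ P′ - Q′ ∣)
    (*-monoˡ (ℚ.0≤∣p∣ (P′ - Q′)) (∣p∣≤
      (≤-offset 0≤s (solve 1 (λ s → con 1ℚ := con 1ℚ :- s :+ s) refl s))
      (≤-offset (0≤-diff s≤2) (solve 1 (λ s → con 1ℚ := (:- (con 1ℚ :- s)) :+ (con 1ℚ :+ con 1ℚ :- s)) refl s))))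

-- Sums of hit indicators over the random tables

module HitSums (c σ r : ℕ) (S : Subset (2 ℕ.^ r)) where

  open Xor r
  open Keys c σ
  open Shift c σ r

  private
    N = 2 ℕ.^ r
    instance
      N≢0 : ℕ.NonZero N
      N≢0 = ℕ.m^n≢0 2 r

    ρ = density r S

  hit : Ω c σ r → Key c σ → ℚ
  hit ω x = indicator (hash c σ r ω x ∈? S)

  density-* : fromℕ N * ρ ≡ fromℕ (card S)
  density-* = trans (ℚ.*-comm (fromℕ N) ρ) (/-* (card S) N)

  -- XOR with `b` permutes the range, so the translates of any hash value meet `S` exactly as often
  -- as `S` has elements.
  sum-translate : ∀ b → sum (λ t → indicator (t ⊕ b ∈? S)) ≡ fromℕ N * ρ
  sum-translate b = begin
    sum (λ t → indicator (t ⊕ b ∈? S)) ≡⟨ sum-cong-≗ (λ t → cong (λ v → indicator (v ∈? S)) (⊕-comm t b)) ⟩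
    sum (λ t → indicator (b ⊕ t ∈? S)) ≡⟨ sum-permute (λ t → indicator (t ∈? S)) (⊕-permutation b) ⟨
    sum (λ t → indicator (t ∈? S))     ≡⟨ fromℕ-card S ⟨
    fromℕ (card S)                     ≡⟨ density-* ⟨
    fromℕ N * ρ                        ∎
    where open ≡-Reasoning

  -- Expresses that `F` does not depend on the entry at position `j` and character `a`: the
  -- translations carry that entry through all its values and fix every other entry.
  ShiftInvariant : Fin c → Fin σ → (Ω c σ r → ℚ) → Set
  ShiftInvariant j a F = ∀ (t : [2^ r ]) ω → F (shift j a t ω) ≡ F ω

  hit-off : ∀ {j a x} → char c σ x j ≢ a → ShiftInvariant j a (λ ω → hit ω x)
  hit-off {j} {a} {x} off t ω = cong (λ v → indicator (v ∈? S)) (hash-shift-off j a t ω x off)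

  -- Average over all translations t of the table entry (j , a): F ω does not
  -- change, while the hash value of x runs through all of [2^ r ].
  sum-*-hit : ∀ {j a x} (F : Ω c σ r → ℚ) → ShiftInvariant j a F → char c σ x j ≡ a →
              sum (λ ω → F ω * hit ω x) ≡ sum F * ρ
  sum-*-hit {j} {a} {x} F inv at = fromℕ-cancelʳ N (begin
    sum (λ ω → F ω * hit ω x) * fromℕ N
      ≡⟨ ℚ.*-comm _ (fromℕ N) ⟩
    fromℕ N * sum (λ ω → F ω * hit ω x)
      ≡⟨ sum-const N _ ⟨
    sum {N} (λ t → sum (λ ω → F ω * hit ω x))
      ≡⟨ sum-cong-≗ (λ t → trans (sum-permute (λ ω → F ω * hit ω x) (shift-permutation j a t))
           (sum-cong-≗ λ ω → cong₂ _*_ (inv t ω) (cong (λ v → indicator (v ∈? S)) (hash-shift j a t ω x at)))) ⟩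
    sum (λ t → sum (λ ω → F ω * indicator (t ⊕ hash c σ r ω x ∈? S)))
      ≡⟨ ∑-comm (λ t ω → F ω * indicator (t ⊕ hash c σ r ω x ∈? S)) ⟩
    sum (λ ω → sum (λ t → F ω * indicator (t ⊕ hash c σ r ω x ∈? S)))
      ≡⟨ sum-cong-≗ (λ ω → trans (sym (*-distribˡ-sum (F ω) (λ t → indicator (t ⊕ hash c σ r ω x ∈? S))))
           (cong (F ω *_) (sum-translate (hash c σ r ω x)))) ⟩
    sum (λ ω → F ω * (fromℕ N * ρ))
      ≡⟨ *-distribʳ-sum (fromℕ N * ρ) F ⟨
    sum F * (fromℕ N * ρ)
      ≡⟨ solve 3 (λ f n ρ → f :* (n :* ρ) := f :* ρ :* n) refl (sum F) (fromℕ N) ρ ⟩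
    sum F * ρ * fromℕ N ∎)
    where open ≡-Reasoning

  0≤hit : ∀ ω x → 0ℚ ≤ hit ω x
  0≤hit ω x = indicator-nonNeg (hash c σ r ω x ∈? S)

  hit≤1 : ∀ ω x → hit ω x ≤ 1ℚ
  hit≤1 ω x = indicator≤1 (hash c σ r ω x ∈? S)

  0≤ρ : 0ℚ ≤ ρ
  0≤ρ = ℚ.nonNegative⁻¹ ρ {{ℚ.normalize-nonNeg (card S) N}}

  ρ≤1 : ρ ≤ 1ℚ
  ρ≤1 = ℚ.*-cancelˡ-≤-pos (fromℕ N) {{fromℕ-pos N}} (subst₂ _≤_
    (trans (sym (fromℕ-card S)) (sym density-*)) (sum-const N 1ℚ)
    (sum-mono λ t → indicator≤1 (t ∈? S)))

  sum-*-total : ∀ {j a} F → ShiftInvariant j a F → ∀ {G} → All (λ x → char c σ x j ≡ a) G →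
                sum (λ ω → F ω * total (hit ω) G) ≡ sum F * total (λ _ → ρ) G
  sum-*-total F inv {[]}    []         = sym (*-distribʳ-sum 0ℚ F)
  sum-*-total F inv {x ∷ G} (at ∷ ats) = begin
    sum (λ ω → F ω * (hit ω x + total (hit ω) G))
      ≡⟨ sum-cong-≗ (λ ω → ℚ.*-distribˡ-+ (F ω) (hit ω x) (total (hit ω) G)) ⟩
    sum (λ ω → F ω * hit ω x + F ω * total (hit ω) G)
      ≡⟨ ∑-distrib-+ (λ ω → F ω * hit ω x) (λ ω → F ω * total (hit ω) G) ⟩
    sum (λ ω → F ω * hit ω x) + sum (λ ω → F ω * total (hit ω) G)
      ≡⟨ cong₂ _+_ (sum-*-hit F inv at) (sum-*-total F inv ats) ⟩
    sum F * ρ + sum F * total (λ _ → ρ) G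
      ≡⟨ ℚ.*-distribˡ-+ (sum F) ρ _ ⟨
    sum F * (ρ + total (λ _ → ρ) G) ∎
    where open ≡-Reasoning

  -- `w` is a probability distribution on the tables that depends on protected entries only. This
  -- covers both the uniform distribution and the one conditioned on the hash value of the query.
  module Weighted
    (w : Ω c σ r → ℚ) (0≤w : ∀ ω → 0ℚ ≤ w ω) (∑w≡1 : sum w ≡ 1ℚ)
    (q : Fin c → Maybe (Fin σ))
    (w-inv : ∀ {j a} → q j ≢ just a → ShiftInvariant j a w)
    where

    -- The entry (i , x[i]) makes h(x) independent of h(y), and the entry (j , a)
    -- makes h(y) independent of w.
    sum-*-hit-hit-sep : ∀ {j a x y} i → q j ≢ just a → char c σ y j ≡ a →
                        q i ≢ just (char c σ x i) → char c σ y i ≢ char c σ x i →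
                        sum (λ ω → w ω * (hit ω y * hit ω x)) ≡ ρ * ρ
    sum-*-hit-hit-sep {j} {a} {x} {y} i free yj xi-free yi≢xi = begin
      sum (λ ω → w ω * (hit ω y * hit ω x))
        ≡⟨ sum-cong-≗ (λ ω → ℚ.*-assoc (w ω) (hit ω y) (hit ω x)) ⟨
      sum (λ ω → w ω * hit ω y * hit ω x)
        ≡⟨ sum-*-hit {i} {x = x} (λ ω → w ω * hit ω y)
             (λ t ω → cong₂ _*_ (w-inv xi-free t ω) (hit-off {x = y} yi≢xi t ω)) refl ⟩
      sum (λ ω → w ω * hit ω y) * ρ
        ≡⟨ cong (_* ρ) (sum-*-hit {x = y} w (w-inv free) yj) ⟩
      sum w * ρ * ρ
        ≡⟨ cong (λ v → v * ρ * ρ) ∑w≡1 ⟩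
      1ℚ * ρ * ρ
        ≡⟨ cong (_* ρ) (ℚ.*-identityˡ ρ) ⟩
      ρ * ρ ∎
      where open ≡-Reasoning

    -- Two distinct keys differ at some position `i`, where at most one of their characters is
    -- protected. The entry of an unprotected one makes that key's hash value independent of the
    -- other's; the shared entry then handles the other key.
    sum-*-hit-hit : ∀ {j a x y} → q j ≢ just a → char c σ x j ≡ a → char c σ y j ≡ a → x ≢ y →
                    sum (λ ω → w ω * (hit ω x * hit ω y)) ≡ ρ * ρ
    sum-*-hit-hit {j} {a} {x} {y} free xj yj x≢y with separating x≢y
    ... | i , xi≢yi with ≡-dec Fin._≟_ (q i) (just (char c σ x i))
    -- The character of `x` is the protected one, so that of `y` is not, and the two keys exchange
    -- roles.
    ...   | yes qi≡xi = sum-*-hit-hit-sep {x = y} {y = x} i free xj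
      (λ qi≡yi → xi≢yi (just-injective (trans (sym qi≡xi) qi≡yi))) xi≢yi
    ...   | no xi-free = trans
      (sum-cong-≗ λ ω → cong (w ω *_) (ℚ.*-comm (hit ω x) (hit ω y)))
      (sum-*-hit-hit-sep {x = x} {y = y} i free yj xi-free (≢-sym xi≢yi))

    sum-*-hit-total : ∀ {j a x G} → q j ≢ just a → char c σ x j ≡ a →
                      All (λ y → char c σ y j ≡ a) G → All (x ≢_) G →
                      sum (λ ω → w ω * (hit ω x * total (hit ω) G)) ≡ ρ * total (λ _ → ρ) G
    sum-*-hit-total {x = x} {[]} free xj [] [] = begin
      sum (λ ω → w ω * (hit ω x * 0ℚ)) ≡⟨ sum-cong-≗ (λ ω → solve 2 (λ a b → a :* (b :* con 0ℚ) := a :* con 0ℚ) refl (w ω) (hit ω x)) ⟩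
      sum (λ ω → w ω * 0ℚ)             ≡⟨ *-distribʳ-sum 0ℚ w ⟨
      sum w * 0ℚ                       ≡⟨ ℚ.*-zeroʳ (sum w) ⟩
      0ℚ                               ≡⟨ ℚ.*-zeroʳ ρ ⟨
      ρ * 0ℚ                           ∎
      where open ≡-Reasoning
    sum-*-hit-total {x = x} {y ∷ G} free xj (yj ∷ ats) (x≢y ∷ x∉G) = begin
      sum (λ ω → w ω * (hit ω x * (hit ω y + total (hit ω) G)))
        ≡⟨ sum-cong-≗ (λ ω → solve 4 (λ a b c d → a :* (b :* (c :+ d)) := a :* (b :* c) :+ a :* (b :* d)) refl
             (w ω) (hit ω x) (hit ω y) (total (hit ω) G)) ⟩
      sum (λ ω → w ω * (hit ω x * hit ω y) + w ω * (hit ω x * total (hit ω) G))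
        ≡⟨ ∑-distrib-+ (λ ω → w ω * (hit ω x * hit ω y)) (λ ω → w ω * (hit ω x * total (hit ω) G)) ⟩
      sum (λ ω → w ω * (hit ω x * hit ω y)) + sum (λ ω → w ω * (hit ω x * total (hit ω) G))
        ≡⟨ cong₂ _+_ (sum-*-hit-hit {x = x} {y} free xj yj x≢y) (sum-*-hit-total free xj ats x∉G) ⟩
      ρ * ρ + ρ * total (λ _ → ρ) G
        ≡⟨ ℚ.*-distribˡ-+ ρ ρ (total (λ _ → ρ) G) ⟨
      ρ * (ρ + total (λ _ → ρ) G) ∎
      where open ≡-Reasoning

    sum-*-pairs : ∀ {j a G} → q j ≢ just a → All (λ y → char c σ y j ≡ a) G → Unique G →
                  sum (λ ω → w ω * pairs (hit ω) G) ≡ pairs (λ _ → ρ) G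
    sum-*-pairs {G = []} free [] [] = trans (sym (*-distribʳ-sum 0ℚ w)) (ℚ.*-zeroʳ (sum w))
    sum-*-pairs {G = x ∷ G} free (xj ∷ ats) (x∉G ∷ uniq) = begin
      sum (λ ω → w ω * (hit ω x * total (hit ω) G + pairs (hit ω) G))
        ≡⟨ sum-cong-≗ (λ ω → ℚ.*-distribˡ-+ (w ω) (hit ω x * total (hit ω) G) (pairs (hit ω) G)) ⟩
      sum (λ ω → w ω * (hit ω x * total (hit ω) G) + w ω * pairs (hit ω) G)
        ≡⟨ ∑-distrib-+ (λ ω → w ω * (hit ω x * total (hit ω) G)) (λ ω → w ω * pairs (hit ω) G) ⟩
      sum (λ ω → w ω * (hit ω x * total (hit ω) G)) + sum (λ ω → w ω * pairs (hit ω) G)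
        ≡⟨ cong₂ _+_ (sum-*-hit-total free xj ats x∉G) (sum-*-pairs free ats uniq) ⟩
      ρ * total (λ _ → ρ) G + pairs (λ _ → ρ) G ∎
      where open ≡-Reasoning

    -- The probability under `w` that no key of `Y` hashes into `S`.
    avoid : List (Key c σ) → ℚ
    avoid Y = sum (λ ω → w ω * misses (hit ω) Y)

    module _ {j a} (free : q j ≢ just a) (Y : List (Key c σ)) (uniq : Unique Y) where

      private
        G = filter (has? j a) Y
        Y′ = filter (¬? ∘ has? j a) Y
        F : Ω c σ r → ℚ
        F ω = w ω * misses (hit ω) Y′
        s = total (λ _ → ρ) G
        t = pairs (λ _ → ρ) G

        F-inv : ShiftInvariant j a F
        F-inv u ω = cong₂ _*_ (w-inv free u ω) (misses-cong
          (All.map (λ {x} off → hit-off {x = x} off u ω) (All.all-filter (¬? ∘ has? j a) Y)))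

        ∑F-total : sum (λ ω → F ω * (1ℚ - total (hit ω) G)) ≡ avoid Y′ * (1ℚ - s)
        ∑F-total = begin
          sum (λ ω → F ω * (1ℚ - total (hit ω) G))
            ≡⟨ sum-cong-≗ (λ ω → solve 2 (λ f t → f :* (con 1ℚ :- t) := f :- f :* t) refl (F ω) (total (hit ω) G)) ⟩
          sum (λ ω → F ω - F ω * total (hit ω) G)
            ≡⟨ sum-diff F (λ ω → F ω * total (hit ω) G) ⟩
          sum F - sum (λ ω → F ω * total (hit ω) G)
            ≡⟨ cong (λ v → sum F - v) (sum-*-total F F-inv (All.all-filter (has? j a) Y)) ⟩
          sum F - sum F * s
            ≡⟨ solve 2 (λ f s → f :- f :* s := f :* (con 1ℚ :- s)) refl (sum F) s ⟩
          sum F * (1ℚ - s) ∎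
          where open ≡-Reasoning

        split : ∀ ω → w ω * misses (hit ω) Y ≡ F ω * misses (hit ω) G
        split ω = trans (cong (w ω *_) (misses-split (has? j a) (hit ω) Y))
          (sym (ℚ.*-assoc (w ω) (misses (hit ω) Y′) (misses (hit ω) G)))

        0≤F : ∀ ω → 0ℚ ≤ F ω
        0≤F ω = 0≤-* (0≤w ω) (misses-nonNeg (hit ω) (0≤hit ω) (hit≤1 ω) Y′)

        F≤w : ∀ ω → F ω ≤ w ω
        F≤w ω = subst (F ω ≤_) (ℚ.*-identityʳ (w ω))
          (*-monoˡ (0≤w ω) (misses≤1 (hit ω) (0≤hit ω) (hit≤1 ω) Y′))

      -- The weight `F` collects `w` and the avoidance by `Y′`. It does not depend on the shared
      -- entry of `G`, so the linear Bonferroni term averages exactly.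
      avoid-lower : avoid Y′ * (1ℚ - s) ≤ avoid Y
      avoid-lower = subst₂ _≤_ ∑F-total (sum-cong-≗ λ ω → sym (split ω))
        (sum-mono λ ω → *-monoˡ (0≤F ω) (bonferroni-lower (hit ω) (0≤hit ω) (hit≤1 ω) G))

      -- In the pair term `F` is first bounded by `w`: the entry that separates two keys of `G` may
      -- occur in the hash values of `Y′`, so pairs are averaged against `w` alone.
      avoid-upper : avoid Y ≤ avoid Y′ * (1ℚ - s) + t
      avoid-upper = subst₂ _≤_ (sum-cong-≗ λ ω → sym (split ω))
        (trans (∑-distrib-+ (λ ω → F ω * (1ℚ - total (hit ω) G)) (λ ω → w ω * pairs (hit ω) G))
          (cong₂ _+_ ∑F-total (sum-*-pairs free (All.all-filter (has? j a) Y) (Unique.filter⁺ (has? j a) uniq))))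
        (sum-mono λ ω → ≤-trans
          (*-monoˡ (0≤F ω) (bonferroni-upper (hit ω) (0≤hit ω) (hit≤1 ω) G))
          (subst (_≤ F ω * (1ℚ - total (hit ω) G) + w ω * pairs (hit ω) G)
            (sym (ℚ.*-distribˡ-+ (F ω) (1ℚ - total (hit ω) G) (pairs (hit ω) G)))
            (ℚ.+-monoʳ-≤ (F ω * (1ℚ - total (hit ω) G))
              (*-monoʳ (pairs-nonNeg (hit ω) (0≤hit ω) G) (F≤w ω)))))

      private
        ideal : List (Key c σ) → ℚ
        ideal = misses (λ _ → ρ)

        ideal-nonNeg : ∀ Z → 0ℚ ≤ ideal Z
        ideal-nonNeg = misses-nonNeg (λ _ → ρ) (λ _ → 0≤ρ) (λ _ → ρ≤1)

        ideal≤1 : ∀ Z → ideal Z ≤ 1ℚ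
        ideal≤1 = misses≤1 (λ _ → ρ) (λ _ → 0≤ρ) (λ _ → ρ≤1)

        -- The fully independent probabilities obey the same recurrence with the same `s` and `t`,
        -- which makes the two sequences comparable group by group.
        ideal-lower : ideal Y′ * (1ℚ - s) ≤ ideal Y
        ideal-lower = subst (ideal Y′ * (1ℚ - s) ≤_) (sym (misses-split (has? j a) (λ _ → ρ) Y))
          (*-monoˡ (ideal-nonNeg Y′) (bonferroni-lower (λ _ → ρ) (λ _ → 0≤ρ) (λ _ → ρ≤1) G))

        ideal-upper : ideal Y ≤ ideal Y′ * (1ℚ - s) + t
        ideal-upper = subst (_≤ ideal Y′ * (1ℚ - s) + t) (sym (misses-split (has? j a) (λ _ → ρ) Y))
          (≤-trans (*-monoˡ (ideal-nonNeg Y′) (bonferroni-upper (λ _ → ρ) (λ _ → 0≤ρ) (λ _ → ρ≤1) G))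
          (subst (_≤ ideal Y′ * (1ℚ - s) + t) (sym (ℚ.*-distribˡ-+ (ideal Y′) (1ℚ - s) t))
          (ℚ.+-monoʳ-≤ (ideal Y′ * (1ℚ - s)) (subst (ideal Y′ * t ≤_) (ℚ.*-identityˡ t)
            (*-monoʳ (pairs-nonNeg (λ _ → ρ) (λ _ → 0≤ρ) G) (ideal≤1 Y′))))))

      gap-step : total {A = Key c σ} (λ _ → ρ) G ≤ 2ℚ →
                 ∣ avoid Y - misses (λ _ → ρ) Y ∣ ≤ ∣ avoid Y′ - misses (λ _ → ρ) Y′ ∣ + pairs (λ _ → ρ) G
      gap-step s≤2 = recurrence-gap {avoid Y} {avoid Y′} {ideal Y} {ideal Y′} {s} {t}
        (total-nonNeg (λ _ → ρ) (λ _ → 0≤ρ) G) s≤2 avoid-lower avoid-upper ideal-lower ideal-upper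

    avoid-nonNeg : ∀ Y → 0ℚ ≤ avoid Y
    avoid-nonNeg Y = sum-nonNeg λ ω → 0≤-* (0≤w ω) (misses-nonNeg (hit ω) (0≤hit ω) (hit≤1 ω) Y)

    avoid≤1 : ∀ Y → avoid Y ≤ 1ℚ
    avoid≤1 Y = subst (avoid Y ≤_) ∑w≡1 (sum-mono λ ω → subst (w ω * misses (hit ω) Y ≤_) (ℚ.*-identityʳ (w ω))
      (*-monoˡ (0≤w ω) (misses≤1 (hit ω) (0≤hit ω) (hit≤1 ω) Y)))

    gap≤1 : ∀ Y → ∣ avoid Y - misses (λ _ → ρ) Y ∣ ≤ 1ℚ
    gap≤1 Y = ∣p∣≤
      (≤-trans (≤-offset (misses-nonNeg (λ _ → ρ) (λ _ → 0≤ρ) (λ _ → ρ≤1) Y)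
        (solve 2 (λ a b → a := a :- b :+ b) refl (avoid Y) (misses (λ _ → ρ) Y))) (avoid≤1 Y))
      (≤-trans (≤-offset (avoid-nonNeg Y)
        (solve 2 (λ a b → b := (:- (a :- b)) :+ a) refl (avoid Y) (misses (λ _ → ρ) Y)))
        (misses≤1 (λ _ → ρ) (λ _ → 0≤ρ) (λ _ → ρ≤1) Y))

    avoid-[] : avoid [] ≡ 1ℚ
    avoid-[] = trans (sum-cong-≗ λ ω → ℚ.*-identityʳ (w ω)) ∑w≡1

    module _ (K m : ℕ)
      (splittable : ∀ Y → 1 ℕ.≤ length Y → length Y ℕ.≤ m → Unique Y → All (Unprotected q) Y → Splittable q K Y) where

      -- Induction over the groups, with `n` bounding the length because `Y′` is not a structural
      -- part of `Y`. A group of `g ≤ K` keys adds at most `g² ρ² ≤ g K ρ²` to the doubled gap, and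
      -- the group sizes add up to the length of `Y`. Fixing `m` keeps the same `K` throughout.
      gap-bound : ∀ n Y → length Y ℕ.≤ n → length Y ℕ.≤ m → Unique Y → All (Unprotected q) Y →
        2ℚ * ∣ avoid Y - misses (λ _ → ρ) Y ∣ ≤ fromℕ (length Y ℕ.* K) * (ρ * ρ)
      gap-bound n [] _ _ _ _ = ≤-reflexive (trans
        (cong (λ v → 2ℚ * ∣ v - 1ℚ ∣) avoid-[]) (sym (ℚ.*-zeroˡ (ρ * ρ))))
      gap-bound (suc n) Y@(_ ∷ _) Y≤n Y≤m uniq unprot = by-cases (ℚ.≤-total (total (λ _ → ρ) G) 2ℚ)
        where
        selected = splittable Y (ℕ.s≤s ℕ.z≤n) Y≤m uniq unprot
        j = proj₁ selected
        a = proj₁ (proj₂ selected)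
        free = proj₁ (proj₂ (proj₂ selected))
        1≤G = proj₁ (proj₂ (proj₂ (proj₂ selected)))
        G≤K = proj₂ (proj₂ (proj₂ (proj₂ selected)))
        G = filter (has? j a) Y
        Y′ = filter (¬? ∘ has? j a) Y
        ∣Y∣≡ : length Y ≡ length Y′ ℕ.+ length G
        ∣Y∣≡ = length-split (has? j a) Y
        Y′<Y : suc (length Y′) ℕ.≤ length Y
        Y′<Y = subst₂ ℕ._≤_ (ℕ.+-comm (length Y′) 1) (sym ∣Y∣≡) (ℕ.+-monoʳ-≤ (length Y′) 1≤G)
        ih : 2ℚ * ∣ avoid Y′ - misses (λ _ → ρ) Y′ ∣ ≤ fromℕ (length Y′ ℕ.* K) * (ρ * ρ)
        ih = gap-bound n Y′ (ℕ.≤-pred (ℕ.≤-trans Y′<Y Y≤n)) (ℕ.≤-trans (ℕ.<⇒≤ Y′<Y) Y≤m)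
          (Unique.filter⁺ (¬? ∘ has? j a) uniq) (All.filter⁺ (¬? ∘ has? j a) unprot)
        0≤ρ² : 0ℚ ≤ ρ * ρ
        0≤ρ² = 0≤-* 0≤ρ 0≤ρ
        G²≤ : fromℕ (length G) * fromℕ (length G) * (ρ * ρ) ≤ fromℕ (length G ℕ.* K) * (ρ * ρ)
        G²≤ = *-monoʳ 0≤ρ² (subst (_≤ fromℕ (length G ℕ.* K)) (fromℕ-* (length G) (length G))
          (fromℕ-mono (ℕ.*-monoʳ-≤ (length G) G≤K)))
        by-cases : total (λ _ → ρ) G ≤ 2ℚ ⊎ 2ℚ ≤ total (λ _ → ρ) G →
          2ℚ * ∣ avoid Y - misses (λ _ → ρ) Y ∣ ≤ fromℕ (length Y ℕ.* K) * (ρ * ρ)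
        by-cases (inj₁ s≤2) = ≤-trans (*-monoˡ 0≤2 (gap-step free Y uniq s≤2))
          (≤-trans (≤-reflexive (ℚ.*-distribˡ-+ 2ℚ ∣ avoid Y′ - misses (λ _ → ρ) Y′ ∣ (pairs (λ _ → ρ) G)))
          (≤-trans (ℚ.+-mono-≤ ih (≤-trans (pairs-const ρ 0≤ρ G) G²≤))
          (≤-reflexive (trans (sym (ℚ.*-distribʳ-+ (ρ * ρ) (fromℕ (length Y′ ℕ.* K)) (fromℕ (length G ℕ.* K))))
            (cong (_* (ρ * ρ)) (trans (sym (fromℕ-+ (length Y′ ℕ.* K) (length G ℕ.* K)))
              (cong fromℕ (trans (sym (ℕ.*-distribʳ-+ K (length Y′) (length G))) (cong (ℕ._* K) (sym ∣Y∣≡))))))))))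
        -- With `s = gρ ≥ 2` the trivial bound suffices: the doubled gap is at most
        -- `2 * 2 ≤ s² = g² ρ² ≤ g K ρ²`, and `g` is at most the length of `Y`.
        by-cases (inj₂ 2≤s) = ≤-trans (*-monoˡ 0≤2 (≤-trans (gap≤1 Y) 1≤2))
          (≤-trans (*-mono 0≤2 (≤-trans 0≤2 2≤s) 2≤s 2≤s)
          (≤-trans (≤-reflexive (trans (cong (λ v → v * v) (total-const ρ G))
            (solve 2 (λ n ρ → n :* ρ :* (n :* ρ) := n :* n :* (ρ :* ρ)) refl (fromℕ (length G)) ρ)))
          (≤-trans G²≤ (*-monoʳ 0≤ρ² (fromℕ-mono (ℕ.*-monoˡ-≤ K (length-filter (has? j a) Y)))))))
          where
          1≤2 : 1ℚ ≤ 2ℚ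
          1≤2 = ≤-offset 0≤1 refl

-- From weighted sums to hit probabilities

fromℕ-injective : ∀ {m n} → fromℕ m ≡ fromℕ n → m ≡ n
fromℕ-injective {m} {n} eq with ℚ./-injective-≃ (ℚᵘ.mkℚᵘ (+ m) 0) (ℚᵘ.mkℚᵘ (+ n) 0) eq
... | ℚᵘ.*≡* eq′ = ℤ.+-injective (trans (sym (ℤ.*-identityʳ (+ m))) (trans eq′ (ℤ.*-identityʳ (+ n))))

elements : ∀ {n} → Subset n → List (Fin n)
elements X = filter (_∈? X) (allFin _)

length-elements : ∀ {n} (X : Subset n) → length (elements X) ≡ card X
length-elements X = fromℕ-injective (trans (fromℕ-length-filter (_∈? X) id) (sym (fromℕ-card X)))

module _ {A : Set} {f : A → ℚ} where

  misses-zero : ∀ {x xs} → x List.∈ xs → f x ≡ 1ℚ → misses f xs ≡ 0ℚ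
  misses-zero {xs = x ∷ xs} (here refl)  fx≡1 = trans (cong (λ v → (1ℚ - v) * misses f xs) fx≡1) (ℚ.*-zeroˡ (misses f xs))
  misses-zero {xs = x ∷ xs} (there x∈xs) fx≡1 = trans (cong ((1ℚ - f x) *_) (misses-zero x∈xs fx≡1)) (ℚ.*-zeroʳ (1ℚ - f x))

  misses-one : ∀ {xs} → All (λ x → f x ≡ 0ℚ) xs → misses f xs ≡ 1ℚ
  misses-one []         = refl
  misses-one (eq ∷ eqs) = cong₂ (λ a b → (1ℚ - a) * b) eq (misses-one eqs)

indicator-true : ∀ {P : Set} (d : Dec P) → P → indicator d ≡ 1ℚ
indicator-true d p rewrite dec-true d p = refl

indicator-false : ∀ {P : Set} (d : Dec P) → ¬ P → indicator d ≡ 0ℚ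
indicator-false d ¬p rewrite dec-false d ¬p = refl

indicator-× : ∀ {P Q : Set} (d : Dec P) (e : Dec Q) → indicator (d ×-dec e) ≡ indicator e * indicator d
indicator-× d e with does d | does e
... | true  | true  = refl
... | true  | false = refl
... | false | true  = refl
... | false | false = refl

-- A single hit annihilates the product `misses`, and without hits all its factors are 1.
indicator-hits : ∀ c σ r X S ω →
  indicator (hits? c σ r X S ω) ≡ 1ℚ - misses (HitSums.hit c σ r S ω) (elements X)
indicator-hits c σ r X S ω with hits? c σ r X S ω
... | yes (x , x∈X , hx∈S) = cong (λ v → 1ℚ - v) (sym (misses-zero
  (∈-filter⁺ (_∈? X) (∈-allFin x) x∈X) (indicator-true (hash c σ r ω x ∈? S) hx∈S)))
... | no ¬hits = cong (λ v → 1ℚ - v) (sym (misses-one (All.map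
  (λ {x} x∈X → indicator-false (hash c σ r ω x ∈? S) λ hx∈S → ¬hits (x , x∈X , hx∈S))
  (All.all-filter (_∈? X) (allFin _)))))

-- The root hypothesis says `K ≤ 2 m^(1-1/c)` for `c = suc k`. Raising the doubled bound to the
-- power `c` turns `m K` into at most `2^c m^(2c-1)`, and `2^c` cancels.
bound-from-root : ∀ {k m K D R} → 0ℚ ≤ D → 0ℚ ≤ R → K ℕ.^ suc k ℕ.≤ 2 ℕ.^ suc k ℕ.* m ℕ.^ k →
  2ℚ * D ≤ fromℕ (m ℕ.* K) * R → D ≤ R · m ^[ 2 ℕ.* suc k ℕ.∸ 1 / suc k ]
bound-from-root {k} {m} {K} {D} {R} 0≤D 0≤R root 2D≤ =
  ℚ.*-cancelˡ-≤-pos (fromℕ (2 ℕ.^ c)) {{fromℕ-pos (2 ℕ.^ c) {{ℕ.m^n≢0 2 c}}}} (begin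
    fromℕ (2 ℕ.^ c) * D ^ℚ c                  ≡⟨ cong (_* D ^ℚ c) (fromℕ-^ 2 c) ⟩
    2ℚ ^ℚ c * D ^ℚ c                          ≡⟨ ^-distrib-* 2ℚ D c ⟨
    (2ℚ * D) ^ℚ c                             ≤⟨ ^-mono c (0≤-* 0≤2 0≤D) 2D≤ ⟩
    (fromℕ (m ℕ.* K) * R) ^ℚ c                ≡⟨ ^-distrib-* (fromℕ (m ℕ.* K)) R c ⟩
    fromℕ (m ℕ.* K) ^ℚ c * R ^ℚ c             ≡⟨ cong (_* R ^ℚ c) (fromℕ-^ (m ℕ.* K) c) ⟨
    fromℕ ((m ℕ.* K) ℕ.^ c) * R ^ℚ c          ≤⟨ *-monoʳ (^-nonNeg c 0≤R) (fromℕ-mono powers) ⟩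
    fromℕ (2 ℕ.^ c ℕ.* m ℕ.^ e) * R ^ℚ c      ≡⟨ cong (_* R ^ℚ c) (fromℕ-* (2 ℕ.^ c) (m ℕ.^ e)) ⟩
    fromℕ (2 ℕ.^ c) * fromℕ (m ℕ.^ e) * R ^ℚ c ≡⟨ solve 3 (λ a b r → a :* b :* r := a :* (r :* b)) refl (fromℕ (2 ℕ.^ c)) (fromℕ (m ℕ.^ e)) (R ^ℚ c) ⟩
    fromℕ (2 ℕ.^ c) * (R ^ℚ c * fromℕ (m ℕ.^ e)) ∎)
  where
  open ℚ.≤-Reasoning
  c e : ℕ
  c = suc k
  e = 2 ℕ.* c ℕ.∸ 1
  -- The exponents combine as `c + k = 2c - 1`, which is `c (2 - 1/c)`.
  powers : (m ℕ.* K) ℕ.^ c ℕ.≤ 2 ℕ.^ c ℕ.* m ℕ.^ e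
  powers = ℕ.≤-trans (ℕ.≤-reflexive (^-distribʳ-* m K c)) (ℕ.≤-trans (ℕ.*-monoʳ-≤ (m ℕ.^ c) root)
    (ℕ.≤-reflexive (trans (trans (sym (ℕ.*-assoc (m ℕ.^ c) (2 ℕ.^ c) (m ℕ.^ k)))
      (trans (cong (ℕ._* m ℕ.^ k) (ℕ.*-comm (m ℕ.^ c) (2 ℕ.^ c))) (ℕ.*-assoc (2 ℕ.^ c) (m ℕ.^ c) (m ℕ.^ k))))
      (cong (2 ℕ.^ c ℕ.*_) (trans (sym (ℕ.^-distribˡ-+-* m c k))
        (cong (m ℕ.^_) (trans (ℕ.+-comm c k) (cong (k ℕ.+_) (sym (ℕ.+-identityʳ c))))))))))

-- B is the indicator of the event conditioned on (n outcomes, h of which hit S).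
module _ (k σ r : ℕ) (X : Subset (σ ℕ.^ suc k)) (S : Subset (2 ℕ.^ r))
  (q : Fin (suc k) → Maybe (Fin σ)) (unprotected : ∀ x → x ∈ X → Keys.Unprotected (suc k) σ q x)
  (B : Ω (suc k) σ r → ℚ) (0≤B : ∀ ω → 0ℚ ≤ B ω)
  (B-inv : ∀ {j a} → q j ≢ just a → HitSums.ShiftInvariant (suc k) σ r S j a B)
  (n : ℕ) .{{n≢0 : NonZero n}} (∑B≡n : sum B ≡ fromℕ n)
  (h : ℕ) (∑B*hits≡h : fromℕ h ≡ sum (λ ω → B ω * indicator (hits? (suc k) σ r X S ω)))
  where

  private
    c m : ℕ
    c = suc k
    m = card X
    ρ 1/n : ℚ
    ρ = density r S
    1/n = + 1 / n
    XL = elements X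

    w : Ω c σ r → ℚ
    w ω = B ω * 1/n

    1/n*n : 1/n * fromℕ n ≡ 1ℚ
    1/n*n = /-* 1 n

    0≤w : ∀ ω → 0ℚ ≤ w ω
    0≤w ω = 0≤-* (0≤B ω) (ℚ.nonNegative⁻¹ 1/n {{ℚ.normalize-nonNeg 1 n}})

    ∑w≡1 : sum w ≡ 1ℚ
    ∑w≡1 = trans (sym (*-distribʳ-sum 1/n B)) (trans (cong (_* 1/n) ∑B≡n)
      (trans (ℚ.*-comm (fromℕ n) 1/n) 1/n*n))

    open HitSums c σ r S
    open Weighted w 0≤w ∑w≡1 q (λ free t ω → cong (_* 1/n) (B-inv free t ω))

    avoid*n : avoid XL * fromℕ n ≡ sum (λ ω → B ω * misses (hit ω) XL)
    avoid*n = trans (*-distribʳ-sum (fromℕ n) (λ ω → w ω * misses (hit ω) XL)) (sum-cong-≗ λ ω → trans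
      (solve 4 (λ b i n v → b :* i :* v :* n := b :* v :* (i :* n)) refl (B ω) 1/n (fromℕ n) (misses (hit ω) XL))
      (trans (cong (B ω * misses (hit ω) XL *_) 1/n*n) (ℚ.*-identityʳ _)))

    prob≡ : + h / n ≡ 1ℚ - avoid XL
    prob≡ = fromℕ-cancelʳ n (begin
      (+ h / n) * fromℕ n ≡⟨ /-* h n ⟩
      fromℕ h ≡⟨ ∑B*hits≡h ⟩
      sum (λ ω → B ω * indicator (hits? c σ r X S ω))
        ≡⟨ sum-cong-≗ (λ ω → trans (cong (B ω *_) (indicator-hits c σ r X S ω))
             (solve 2 (λ b v → b :* (con 1ℚ :- v) := b :- b :* v) refl (B ω) (misses (hit ω) XL))) ⟩
      sum (λ ω → B ω - B ω * misses (hit ω) XL) ≡⟨ sum-diff B (λ ω → B ω * misses (hit ω) XL) ⟩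
      sum B - sum (λ ω → B ω * misses (hit ω) XL) ≡⟨ cong₂ _-_ ∑B≡n (sym avoid*n) ⟩
      fromℕ n - avoid XL * fromℕ n ≡⟨ solve 2 (λ n a → n :- a :* n := (con 1ℚ :- a) :* n) refl (fromℕ n) (avoid XL) ⟩
      (1ℚ - avoid XL) * fromℕ n ∎)
      where open ≡-Reasoning

    -- Both probabilities are complements of avoidance probabilities, so the difference only changes
    -- sign.
    gap≡ : ∣ avoid XL - misses (λ _ → ρ) XL ∣ ≡ ∣ + h / n - p₀′ m ρ ∣
    gap≡ = trans (sym (ℚ.∣-p∣≡∣p∣ (avoid XL - misses (λ _ → ρ) XL))) (cong ∣_∣ (begin
      - (avoid XL - misses (λ _ → ρ) XL)
        ≡⟨ solve 2 (λ a b → :- (a :- b) := con 1ℚ :- a :- (con 1ℚ :- b)) refl (avoid XL) (misses (λ _ → ρ) XL) ⟩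
      1ℚ - avoid XL - (1ℚ - misses (λ _ → ρ) XL)
        ≡⟨ cong₂ (λ u v → u - (1ℚ - v)) (sym prob≡) (trans (misses-const ρ XL) (cong ((1ℚ - ρ) ^ℚ_) (length-elements X))) ⟩
      + h / n - p₀′ m ρ ∎))
      where open ≡-Reasoning

  hit-probability-bound : ∣ + h / n - p₀′ m ρ ∣ ≤ ρ ^ℚ 2 · m ^[ 2 ℕ.* c ℕ.∸ 1 / c ]
  hit-probability-bound with floor-root c (2 ℕ.^ c ℕ.* m ℕ.^ k)
  -- `K` is the integer part of `2 m^(1-1/c)`: its lower inequality feeds the final bound, its upper
  -- one the existence of small groups.
  ... | K , K≤ , <K = bound-from-root {k} {m} {K} (ℚ.0≤∣p∣ (+ h / n - p₀′ m ρ))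
    (^-nonNeg 2 0≤ρ) K≤ (subst₂ _≤_ (cong (2ℚ *_) gap≡)
      (cong₂ (λ u v → fromℕ (u ℕ.* K) * v) (length-elements X) (cong (ρ *_) (sym (ℚ.*-identityʳ ρ))))
      (gap-bound K m (small-group-exists q <K) (length XL) XL ℕ.≤-refl (ℕ.≤-reflexive (length-elements X))
        (Unique.filter⁺ (_∈? X) (Unique.allFin⁺ _))
        (All.map (unprotected _) (All.all-filter (_∈? X) (allFin _)))))

-- The uniform and the conditioned distribution as instances

theorem5 :
    ∀ (c σ r : ℕ) .{{_ : NonZero c}} (m : ℕ) (X : Subset (σ ℕ.^ c)) → card X ≡ m →
      (∀ (S : Subset (2 ℕ.^ r)) →
        let ρ = density r S
            p = hitProb c σ r X S
        in ∣ p - p₀′ m ρ ∣ ≤ ρ ^ℚ 2 · m ^[ 2 ℕ.* c ℕ.∸ 1 / c ])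
      ×
      (∀ (q : Key c σ) → q ∉ X → (S : [2^ r ] → Subset (2 ℕ.^ r)) (z : [2^ r ]) →
        let ρ = density r (S z)
            p = condHitProb c σ r X (S z) q z
        in ∣ p - p₀′ m ρ ∣ ≤ fromℕ 2 * ρ ^ℚ 2 · m ^[ 2 ℕ.* c ℕ.∸ 1 / c ])
theorem5 zero σ r {{c≢0}} m X _ = ⊥-elim-irr (NonZero.nonZero c≢0)
theorem5 c@(suc k) σ r m X refl = unconditional , conditional
  where
  open Shift c σ r
  unconditional : ∀ S → ∣ hitProb c σ r X S - p₀′ m (density r S) ∣ ≤ density r S ^ℚ 2 · m ^[ 2 ℕ.* c ℕ.∸ 1 / c ]
  -- No character is protected and every table has weight 1; position `zero` exists because
  -- `c = suc k`.
  unconditional S = hit-probability-bound k σ r X S (λ _ → nothing) (λ x _ → zero , λ ())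
    (λ _ → 1ℚ) (λ _ → 0≤1) (λ _ _ _ → refl)
    (∣Ω∣ c σ r) {{∣Ω∣-nonZero c σ r}} (trans (sum-const (∣Ω∣ c σ r) 1ℚ) (ℚ.*-identityʳ _))
    (count (hits? c σ r X S)) (trans (fromℕ-length-filter (hits? c σ r X S) id)
      (sum-cong-≗ λ ω → sym (ℚ.*-identityˡ (indicator (hits? c σ r X S ω)))))
  conditional : ∀ (q : Key c σ) → q ∉ X → (S : [2^ r ] → Subset (2 ℕ.^ r)) (z : [2^ r ]) →
    ∣ condHitProb c σ r X (S z) q z - p₀′ m (density r (S z)) ∣ ≤ fromℕ 2 * density r (S z) ^ℚ 2 · m ^[ 2 ℕ.* c ℕ.∸ 1 / c ]
  conditional q q∉X S z = ≤-trans
    -- Once `z` is fixed, so is `S z`. The characters of `q` are protected, and the weight is the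
    -- indicator of `h(q) = z`, normalised by its count.
    (hit-probability-bound k σ r X (S z) (just ∘ char c σ q) unprot
      (λ ω → indicator (hashesTo? c σ r q z ω)) (λ ω → indicator-nonNeg (hashesTo? c σ r q z ω)) (λ {j} {a} → inv {j} {a})
      (count (hashesTo? c σ r q z)) {{hashesTo-nonZero c σ r q z}} (sym (fromℕ-length-filter (hashesTo? c σ r q z) id))
      (count (hits? c σ r X (S z) ∩? hashesTo? c σ r q z))
      (trans (fromℕ-length-filter (hits? c σ r X (S z) ∩? hashesTo? c σ r q z) id)
        (sum-cong-≗ λ ω → indicator-× (hits? c σ r X (S z) ω) (hashesTo? c σ r q z ω))))
    -- Passes from `ρ²` to `2 ρ²` under the power `c`.
    (*-monoʳ (fromℕ-nonNeg (m ℕ.^ (2 ℕ.* c ℕ.∸ 1)))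
      (^-mono c 0≤ρ² (≤-offset 0≤ρ² (solve 1 (λ x → (con 1ℚ :+ con 1ℚ) :* x := x :+ x) refl (ρ ^ℚ 2)))))
    where
    ρ = density r (S z)
    0≤ρ² : 0ℚ ≤ ρ ^ℚ 2
    0≤ρ² = ^-nonNeg 2 (HitSums.0≤ρ c σ r (S z))
    unprot : ∀ x → x ∈ X → Keys.Unprotected c σ (just ∘ char c σ q) x
    unprot x x∈X with Keys.separating c σ {q} {x} (λ { refl → q∉X x∈X })
    ... | j , qj≢xj = j , λ eq → qj≢xj (just-injective eq)
    inv : ∀ {j a} → just (char c σ q j) ≢ just a → HitSums.ShiftInvariant c σ r (S z) j a (λ ω → indicator (hashesTo? c σ r q z ω))
    -- An unprotected entry is not one that `q` reads, so translating it leaves the event `h(q) = z`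
    -- unchanged.
    inv {j} {a} free t ω = cong (λ v → indicator (v Fin.≟ z)) (hash-shift-off j a t ω q (free ∘ cong just))
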